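{- Let $m \geq 2$ be an integer, let $k$ be a field containing a primitive $m$-th root of unity, and let $f = X^{\nu}$ be a fundamental invariant of the standard representation of the cyclic group $G$ of order $m$ over $k$. (i) If $\deg X^{\nu} + \sigma(\nu) = m+1$, then $\sigma(\nu) \leq 2$, except when $m = 6$ and $f = X_1 X_2^0 X_3 X_4^2 = X_1 X_3 X_4^2$ or $f = X_2^2 X_3 X_5$. (ii) If $m \geq 3$, $m \neq 6$, and $\deg X^{\nu} + \sigma(\nu) = m+1$, then the monomial $f$ contains a variable $X_i$ of degree $\nu_i \geq m-2$. (iii) If $m \geq 7$ and $f$ contains $s \geq 3$ different variables (i.e. $\sigma(\nu) = s \geq 3$), then its total degree is bounded by $\deg f \leq m - \sigma(\nu)$.
   Context: Let $\varepsilon \in k$ be a fixed primitive $m$-th root of unity and $A$ a fixed generator of the cyclic group $G$ of order $m$. The standard representation is the action of $G$ on the polynomial ring $k[X_1,\ldots,X_{m-1}]$ by $k$-algebra automorphisms with $A \cdot X_i = \varepsilon^{i} X_i$ for $i = 1,\ldots,m-1$. For $\nu = (\nu_1,\ldots,\nu_{m-1}) \in \mathbb{N}^{m-1}$ ($\mathbb{N} = \{0,1,2,\ldots\}$) write $X^{\nu} = X_1^{\nu_1}\cdots X_{m-1}^{\nu_{m-1}}$; $\deg X^{\nu} = \nu_1 + \cdots + \nu_{m-1}$ and $\sigma(\nu) = \#\{i : \nu_i \neq 0\}$ is the number of different variables occurring in $X^\nu$. A fundamental invariant is a monomial $X^{\nu}$ for which $\nu$ is an indecomposable solution of $\nu_1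 + 2\nu_2 + \cdots + (m-1)\nu_{m-1} \equiv 0 \pmod m$, that is, nonzero and minimal (componentwise) among the nonzero solutions in $\mathbb{N}^{m-1}$; these monomials form the minimal system of generators of the invariant algebra consisting of monomials. -}

module Defs where

open import Algebra.Apartness.Bundles using (HeytingCommutativeRing; HeytingField)
open import Algebra.Bundles using (CommutativeRing; RawSemiring; Semiring)
import Algebra.Definitions.RawSemiring as RawSemiringDefinitions
open import Data.Bool using (if_then_else_)
open import Data.Empty.Polymorphic using (⊥)
open import Data.Fin using (Fin; #_; toℕ)
open import Data.List as List using (List; []; _∷_; [_]; _++_; cartesianProductWith)
open import Data.Nat using (ℕ; suc; _+_; _*_; _∸_; _≤_; _<_; _≟_)
open import Data.Nat.Divisibility using (_∣_)
open import Data.Product using (_×_; _,_; proj₁; proj₂)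
open import Data.Sum using (_⊎_)
open import Data.Vec as Vec using (Vec; lookup; replicate; tabulate; zipWith; _[_]≔_)
open import Data.Vec.Properties using (≡-dec)
open import Data.Vec.Relation.Binary.Pointwise.Inductive using (Pointwise)
open import Level using (_⊔_)
open import Relation.Binary.PropositionalEquality using (_≡_; _≢_)
open import Relation.Nullary using (¬_; does; ¬?)

Exponents : ℕ → Set
Exponents n = Vec ℕ n

𝟎 : ∀ {n} → Exponents n
𝟎 = replicate _ 0

deg : ∀ {n} → Exponents n → ℕ
deg = Vec.sum

σ : ∀ {n} → Exponents n → ℕ
σ = Vec.count (λ e → ¬? (e ≟ 0))

-- ν₁ + 2ν₂ + ⋯ + nνₙ; the entry νᵢ sits at the position of Fin n with value i - 1.
weight : ∀ {n} → Exponents n → ℕ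
weight ν = Vec.sum (tabulate λ i → suc (toℕ i) * lookup ν i)

record IsNonzeroSolution (m : ℕ) (ν : Exponents (m ∸ 1)) : Set where
  field
    m∣weight : m ∣ weight ν
    nonzero  : ν ≢ 𝟎

record IsIndecomposable (m : ℕ) (ν : Exponents (m ∸ 1)) : Set where
  field
    isNonzeroSolution : IsNonzeroSolution m ν
    minimal           : ∀ μ → IsNonzeroSolution m μ → Pointwise _≤_ μ ν → μ ≡ ν

module _ {c ℓ₁ ℓ₂} (k : HeytingField c ℓ₁ ℓ₂) where

  private
    module k = CommutativeRing
      (HeytingCommutativeRing.commutativeRing (HeytingField.heytingCommutativeRing k))
    module k^ = RawSemiringDefinitions (Semiring.rawSemiring k.semiring)

  record IsPrimitiveRoot (m : ℕ) (ε : k.Carrier) : Set ℓ₁ where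
    field
      ε^m≈1 : ε k^.^ m k.≈ k.1#
      ε^j≉1 : ∀ j → 0 < j → j < m → ¬ (ε k^.^ j k.≈ k.1#)

  -- A polynomial in n variables is a formal sum of terms c·X^μ, in which an
  -- exponent vector may occur repeatedly; equality compares total coefficients.
  Polynomial : ℕ → Set c
  Polynomial n = List (k.Carrier × Exponents n)

  coefficient : ∀ {n} → Polynomial n → Exponents n → k.Carrier
  coefficient []            μ = k.0#
  coefficient ((a , ν) ∷ p) μ =
    (if does (≡-dec _≟_ ν μ) then a else k.0#) k.+ coefficient p μ

  k[X] : ℕ → RawSemiring c ℓ₁
  k[X] n = record
    { Carrier = Polynomial n
    ; _≈_     = λ p q → ∀ μ → coefficient p μ k.≈ coefficient q μ
    ; _+_     = _++_
    ; _*_     = cartesianProductWith λ s t →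
                  proj₁ s k.* proj₁ t , zipWith _+_ (proj₂ s) (proj₂ t)
    ; 0#      = []
    ; 1#      = [ (k.1# , 𝟎) ]
    }

  -- X i is the variable with 1-based index toℕ i + 1.
  X : ∀ {n} → Fin n → Polynomial n
  X i = [ (k.1# , 𝟎 [ i ]≔ 1) ]

  X^_ : ∀ {n} → Exponents n → Polynomial n
  X^_ {n} ν = product λ i → X i ^ lookup ν i
    where open RawSemiringDefinitions (k[X] n)

  record IsFundamentalInvariant (m : ℕ) (f : Polynomial (m ∸ 1))
                                (ν : Exponents (m ∸ 1)) : Set ℓ₁ where
    open RawSemiring (k[X] (m ∸ 1)) using (_≈_)
    field
      f≈X^ν            : f ≈ (X^ ν)
      isIndecomposable : IsIndecomposable m ν

  -- X₁X₃X₄² and X₂²X₃X₅ for m = 6; the variables are numbered from 0 here.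
  IsExceptional : (m : ℕ) → Polynomial (m ∸ 1) → Set ℓ₁
  IsExceptional 6 f =
    f ≈ X (# 0) ⊗ X (# 2) ⊗ X (# 3) ^ 2 ⊎ f ≈ X (# 1) ^ 2 ⊗ X (# 2) ⊗ X (# 4)
    where
    open RawSemiring (k[X] 5) using (_≈_) renaming (_*_ to infixl 7 _⊗_)
    open RawSemiringDefinitions (k[X] 5) using (_^_)
  IsExceptional _ f = ⊥

module Submission where

-- Write ℓ = deg ν, s = σ ν. If ν is cut into consecutive blocks, sums of nonempty parts of a block,
-- shifted by the sum of the earlier blocks, are incongruent mod m for different blocks: otherwise a
-- proper part of ν would sum to 0. Hence a block B with |B| + h distinct sums gives ℓ + h ≤ m.
-- For s = 2 and both exponents ≥ 2, two blocks xy with three sums each give ℓ + 2 ≤ m.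
-- For s ≥ 3 the elements of the support and their negatives show 2s ≤ m, which settles ℓ = s. If
-- ℓ > s, it suffices that the support has 2s sums. Three elements have six sums unless 2a = 0 and
-- c = a + b up to order; an element of order two adds two sums to any zero-sum free set; and from
-- any zero-sum free multiset with two different elements one can be removed that loses two sums.
-- There remains s = 3 with 2a = 0, c = a + b: here abbc has seven sums unless it is all of ν, and
-- then m ≥ 6, with the two exceptions at m = 6.

open import Algebra.Apartness.Bundles using (HeytingCommutativeRing; HeytingField)
open import Algebra.Bundles using (CommutativeMonoid; CommutativeRing; RawSemiring)
import Algebra.Definitions.RawMonoid as RawMonoidDefinitions
import Algebra.Definitions.RawSemiring as RawSemiringDefinitions
import Algebra.Solver.CommutativeMonoid as CommutativeMonoidSolver
open import Data.Bool using (true; false)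
open import Data.Empty using (⊥)
open import Data.Fin as Fin using (Fin; zero; suc; toℕ; #_)
import Data.Fin.Properties as Fin
open import Data.Integer as ℤ using (ℤ; +_; 0ℤ)
open import Data.Integer.DivMod using (_%ℕ_; _/ℕ_; n%ℕd<d; a≡a%ℕn+[a/ℕn]*n)
open import Data.Integer.Divisibility.Signed
  using (_∣_; divides; _∣?_; ∣⇒∣ᵤ; ∣ᵤ⇒∣; ∣m∣n⇒∣m+n; ∣m∣n⇒∣m-n; ∣m+n∣n⇒∣m; ∣m⇒∣-m)
import Data.Integer.Properties as ℤ
import Data.Integer.Tactic.RingSolver as ℤ-Solver
open import Data.List as List using (List; []; _∷_; _++_; length; map)
open import Data.List.Membership.Propositional using (_∈_)
open import Data.List.Membership.Propositional.Properties using (∈-∃++; ∈-lookup; ∈-map⁺)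
open import Data.List.Properties as List using (length-++; length-map)
open import Data.List.Relation.Binary.Permutation.Propositional
  using (_↭_; refl; prep; swap; ↭-refl; ↭-sym; ↭-trans; ↭⇒↭ₛ)
open import Data.List.Relation.Binary.Permutation.Propositional.Properties
  using (All-resp-↭; shift; ∈-resp-↭; ↭-length)
import Data.List.Relation.Binary.Permutation.Setoid.Properties as Permutationₛ
open import Data.List.Relation.Binary.Sublist.Propositional using (_⊆_; []; _∷_; _∷ʳ_)
open import Data.List.Relation.Unary.All as All using (All; []; _∷_)
import Data.List.Relation.Unary.All.Properties as All
open import Data.List.Relation.Unary.AllPairs as AllPairs using (AllPairs; []; _∷_)
import Data.List.Relation.Unary.AllPairs.Properties as AllPairs
open import Data.List.Relation.Unary.Any using (here; there)
open import Data.List.Relation.Unary.Unique.Propositional using (Unique)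
import Data.List.Relation.Unary.Unique.Propositional.Properties as Unique
open import Data.Nat as ℕ using (ℕ; zero; suc; pred; _≤_; _<_; s≤s; z≤n)
import Data.Nat.Divisibility as ℕ
open import Data.Nat.ListAction using (sum)
import Data.Nat.Properties as ℕ
import Data.Nat.Tactic.RingSolver as ℕ-Solver
open import Data.Product using (_×_; _,_; proj₂; ∃₂; ∃-syntax)
open import Data.Sum using (_⊎_; inj₁; inj₂)
open import Data.Vec as Vec using ([]; _∷_; lookup; tabulate; zipWith; _[_]≔_)
import Data.Vec.Properties as Vec
open import Data.Vec.Relation.Binary.Pointwise.Inductive using (Pointwise; []; _∷_)
open import Function using (_∘_)
open import Level using (_⊔_)
open import Relation.Binary.Definitions using (Tri; tri<; tri≈; tri>)
open import Relation.Binary.PropositionalEquality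
open import Relation.Nullary using (¬_; Dec; does; yes; no; contradiction)
open import Relation.Nullary.Decidable using (decidable-stable; from-yes; _→-dec_; _⊎-dec_)
open import Defs

-- Exponent vectors: addition, degree and linear forms

infixr 6 _⊕_

_⊕_ : ∀ {n} → Exponents n → Exponents n → Exponents n
_⊕_ = zipWith ℕ._+_

⊕-commutativeMonoid : ℕ → CommutativeMonoid _ _
⊕-commutativeMonoid n = record
  { Carrier = Exponents n
  ; _≈_     = _≡_
  ; _∙_     = _⊕_
  ; ε       = 𝟎
  ; isCommutativeMonoid = record
    { isMonoid = record
      { isSemigroup = record
        { isMagma = isMagma _⊕_
        ; assoc   = Vec.zipWith-assoc ℕ.+-assoc
        }
      ; identity = Vec.zipWith-identityˡ ℕ.+-identityˡ , Vec.zipWith-identityʳ ℕ.+-identityʳ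
      }
    ; comm = Vec.zipWith-comm ℕ.+-comm
    }
  }

module ⊕ {n : ℕ} = CommutativeMonoid (⊕-commutativeMonoid n)
module ⊕-Solver {n : ℕ} = CommutativeMonoidSolver (⊕-commutativeMonoid n)

open ⊕-Solver using (solve; _⊜_; id) renaming (_⊕_ to infixr 6 _⊕′_)

⊕-cancelˡ : ∀ {n} (U : Exponents n) {V W} → U ⊕ V ≡ U ⊕ W → V ≡ W
⊕-cancelˡ []      {[]}    {[]}    _  = refl
⊕-cancelˡ (x ∷ U) {y ∷ V} {z ∷ W} eq = cong₂ _∷_
  (ℕ.+-cancelˡ-≡ x y z (Vec.∷-injectiveˡ eq)) (⊕-cancelˡ U (Vec.∷-injectiveʳ eq))

U⊕V≡𝟎⇒U≡𝟎 : ∀ {n} (U V : Exponents n) → U ⊕ V ≡ 𝟎 → U ≡ 𝟎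
U⊕V≡𝟎⇒U≡𝟎 []      []      _  = refl
U⊕V≡𝟎⇒U≡𝟎 (x ∷ U) (y ∷ V) eq = cong₂ _∷_
  (ℕ.m+n≡0⇒m≡0 x (Vec.∷-injectiveˡ eq)) (U⊕V≡𝟎⇒U≡𝟎 U V (Vec.∷-injectiveʳ eq))

⊕-≢𝟎ˡ : ∀ {n} {U V : Exponents n} → U ≢ 𝟎 → U ⊕ V ≢ 𝟎
⊕-≢𝟎ˡ U≢𝟎 eq = U≢𝟎 (U⊕V≡𝟎⇒U≡𝟎 _ _ eq)

⊕-≢𝟎ʳ : ∀ {n} {U V : Exponents n} → V ≢ 𝟎 → U ⊕ V ≢ 𝟎
⊕-≢𝟎ʳ {U = U} {V} V≢𝟎 eq = V≢𝟎 (U⊕V≡𝟎⇒U≡𝟎 V U (trans (⊕.comm V U) eq))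

e : ∀ {n} → Fin n → Exponents n
e i = 𝟎 [ i ]≔ 1

e≢𝟎 : ∀ {n} (i : Fin n) → e i ≢ 𝟎
e≢𝟎 zero    ()
e≢𝟎 (suc i) eq = e≢𝟎 i (Vec.∷-injectiveʳ eq)

lookup-⊕ : ∀ {n} (i : Fin n) (U V : Exponents n) → lookup (U ⊕ V) i ≡ lookup U i ℕ.+ lookup V i
lookup-⊕ = Vec.lookup-zipWith ℕ._+_

deg-⊕ : ∀ {n} (U V : Exponents n) → deg (U ⊕ V) ≡ deg U ℕ.+ deg V
deg-⊕ []      []      = refl
deg-⊕ (x ∷ U) (y ∷ V) = trans (cong (x ℕ.+ y ℕ.+_) (deg-⊕ U V)) (interchange x y (deg U) (deg V))
  where
  interchange : ∀ a b c d → a ℕ.+ b ℕ.+ (c ℕ.+ d) ≡ a ℕ.+ c ℕ.+ (b ℕ.+ d)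
  interchange = ℕ-Solver.solve-∀

deg-𝟎 : ∀ n → deg (𝟎 {n}) ≡ 0
deg-𝟎 zero    = refl
deg-𝟎 (suc n) = deg-𝟎 n

deg-e : ∀ {n} (i : Fin n) → deg (e i) ≡ 1
deg-e {suc n} zero = cong suc (deg-𝟎 n)
deg-e (suc i) = deg-e i

-- Arbitrary coefficients let inductions on the vector pass to `c ∘ suc`; `weight` is the case
-- `suc ∘ toℕ`.
linear : ∀ {n} → (Fin n → ℕ) → Exponents n → ℕ
linear c ν = Vec.sum (tabulate λ i → c i ℕ.* lookup ν i)

linear-⊕ : ∀ {n} (c : Fin n → ℕ) U V → linear c (U ⊕ V) ≡ linear c U ℕ.+ linear c V
linear-⊕ c []      []      = refl
linear-⊕ c (x ∷ U) (y ∷ V) =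
  trans (cong (c zero ℕ.* (x ℕ.+ y) ℕ.+_) (linear-⊕ (c ∘ suc) U V)) (rearrange (c zero) x y _ _)
  where
  rearrange : ∀ a b d p q → a ℕ.* (b ℕ.+ d) ℕ.+ (p ℕ.+ q) ≡ a ℕ.* b ℕ.+ p ℕ.+ (a ℕ.* d ℕ.+ q)
  rearrange = ℕ-Solver.solve-∀

linear-𝟎 : ∀ {n} (c : Fin n → ℕ) → linear c 𝟎 ≡ 0
linear-𝟎 {zero}  c = refl
linear-𝟎 {suc n} c = cong₂ ℕ._+_ (ℕ.*-zeroʳ (c zero)) (linear-𝟎 (c ∘ suc))

linear-e : ∀ {n} (c : Fin n → ℕ) i → linear c (e i) ≡ c i
linear-e {suc n} c zero = trans (cong₂ ℕ._+_ (ℕ.*-identityʳ (c zero)) (linear-𝟎 (c ∘ suc)))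
                        (ℕ.+-identityʳ (c zero))
linear-e c (suc i) = cong₂ ℕ._+_ (ℕ.*-zeroʳ (c zero)) (linear-e (c ∘ suc) i)

-- Exponent vectors as multisets of indices

⟦_⟧ : ∀ {n} → List (Fin n) → Exponents n
⟦ []    ⟧ = 𝟎
⟦ i ∷ I ⟧ = e i ⊕ ⟦ I ⟧

⟦⟧-↭ : ∀ {n} {I J : List (Fin n)} → I ↭ J → ⟦ I ⟧ ≡ ⟦ J ⟧
⟦⟧-↭ refl         = refl
⟦⟧-↭ (prep i p)   = cong (e i ⊕_) (⟦⟧-↭ p)
⟦⟧-↭ (swap {xs} {ys} i j p) = trans (cong (λ V → e i ⊕ e j ⊕ V) (⟦⟧-↭ p))
  (solve 3 (λ a b c → a ⊕′ b ⊕′ c ⊜ b ⊕′ a ⊕′ c) refl (e i) (e j) ⟦ ys ⟧)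
⟦⟧-↭ (_↭_.trans p q)  = trans (⟦⟧-↭ p) (⟦⟧-↭ q)

⟦⟧-++ : ∀ {n} (I J : List (Fin n)) → ⟦ I List.++ J ⟧ ≡ ⟦ I ⟧ ⊕ ⟦ J ⟧
⟦⟧-++ []      J = sym (⊕.identityˡ ⟦ J ⟧)
⟦⟧-++ (i ∷ I) J = trans (cong (e i ⊕_) (⟦⟧-++ I J)) (sym (⊕.assoc (e i) ⟦ I ⟧ ⟦ J ⟧))

deg-⟦⟧ : ∀ {n} (I : List (Fin n)) → deg ⟦ I ⟧ ≡ length I
deg-⟦⟧ {n} [] = deg-𝟎 n
deg-⟦⟧ (i ∷ I) = trans (deg-⊕ (e i) ⟦ I ⟧) (cong₂ ℕ._+_ (deg-e i) (deg-⟦⟧ I))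

⟦map-suc⟧ : ∀ {n} (I : List (Fin n)) → ⟦ List.map suc I ⟧ ≡ 0 ∷ ⟦ I ⟧
⟦map-suc⟧ []      = refl
⟦map-suc⟧ (i ∷ I) = cong (e (suc i) ⊕_) (⟦map-suc⟧ I)

⟦⟧-surjective : ∀ {n} (V : Exponents n) → ∃[ I ] ⟦ I ⟧ ≡ V
⟦⟧-surjective []      = [] , refl
⟦⟧-surjective (x ∷ V) with I , refl ← ⟦⟧-surjective V = build x
  where
  build : ∀ x → ∃[ J ] ⟦ J ⟧ ≡ x ∷ ⟦ I ⟧
  build zero    = List.map suc I , ⟦map-suc⟧ I
  build (suc x) with J , eq ← build x =
    zero ∷ J , trans (cong (e zero ⊕_) eq) (cong (suc x ∷_) (⊕.identityˡ ⟦ I ⟧))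

split-≢𝟎 : ∀ {n} {V : Exponents n} → V ≢ 𝟎 → ∃₂ λ i W → e i ⊕ W ≡ V
split-≢𝟎 {V = V} V≢𝟎 with ⟦⟧-surjective V
... | []    , eq = contradiction (sym eq) V≢𝟎
... | i ∷ I , eq = i , ⟦ I ⟧ , eq

split-lookup : ∀ {n} (V : Exponents n) i → lookup V i ≢ 0 → ∃[ W ] e i ⊕ W ≡ V
split-lookup (zero  ∷ V) zero    ≢0 = contradiction refl ≢0
split-lookup (suc x ∷ V) zero    _  = x ∷ V , cong (suc x ∷_) (⊕.identityˡ V)
split-lookup (x     ∷ V) (suc i) ≢0 with W , refl ← split-lookup V i ≢0 = x ∷ W , refl

lookup-𝟎 : ∀ {n} (i : Fin n) → lookup (𝟎 {n}) i ≡ 0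
lookup-𝟎 i = Vec.lookup-replicate i 0

lookup-e-≢ : ∀ {n} {i j : Fin n} → i ≢ j → lookup (e i) j ≡ 0
lookup-e-≢ {i = i} {j} i≢j = trans (Vec.lookup∘updateAt′ j i (i≢j ∘ sym) 𝟎) (lookup-𝟎 j)

-- Support of an exponent vector

support : ∀ {n} → Exponents n → List (Fin n)
support []          = []
support (zero  ∷ ν) = List.map suc (support ν)
support (suc x ∷ ν) = zero ∷ List.map suc (support ν)

length-support : ∀ {n} (ν : Exponents n) → length (support ν) ≡ σ ν
length-support []          = refl
length-support (zero  ∷ ν) = trans (length-map suc (support ν)) (length-support ν)
length-support (suc x ∷ ν) = cong suc (trans (length-map suc (support ν)) (length-support ν))

support-unique : ∀ {n} (ν : Exponents n) → Unique (support ν)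
support-unique []          = []
support-unique (zero  ∷ ν) = Unique.map⁺ Fin.suc-injective (support-unique ν)
support-unique (suc x ∷ ν) =
  All.map⁺ (All.universal (λ _ ()) _) ∷ Unique.map⁺ Fin.suc-injective (support-unique ν)

-- Splits off the squarefree part; what is left records the repetitions and vanishes exactly when
-- `deg ν` equals `σ ν`.
⟦support⟧⊕pred : ∀ {n} (ν : Exponents n) → ⟦ support ν ⟧ ⊕ Vec.map pred ν ≡ ν
⟦support⟧⊕pred []          = refl
⟦support⟧⊕pred (zero  ∷ ν) rewrite ⟦map-suc⟧ (support ν) = cong (0 ∷_) (⟦support⟧⊕pred ν)
⟦support⟧⊕pred (suc x ∷ ν) rewrite ⟦map-suc⟧ (support ν) | ⊕.identityˡ ⟦ support ν ⟧ =
  cong (suc x ∷_) (⟦support⟧⊕pred ν)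

∈-support : ∀ {n} (i : Fin n) (V : Exponents n) → i ∈ support (e i ⊕ V)
∈-support zero    (y     ∷ V) = here refl
∈-support (suc i) (zero  ∷ V) = ∈-map⁺ suc (∈-support i V)
∈-support (suc i) (suc y ∷ V) = there (∈-map⁺ suc (∈-support i V))

deg≡Σsupport : ∀ {n} (ν : Exponents n) → deg ν ≡ sum (List.map (lookup ν) (support ν))
deg≡Σsupport []          = refl
deg≡Σsupport (zero  ∷ ν) = trans (deg≡Σsupport ν) (cong sum (List.map-∘ (support ν)))
deg≡Σsupport (suc x ∷ ν) =
  cong (suc x ℕ.+_) (trans (deg≡Σsupport ν) (cong sum (List.map-∘ (support ν))))

⊕⇒≤ : ∀ {n} {U V W : Exponents n} → U ⊕ V ≡ W → Pointwise _≤_ U W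
⊕⇒≤ {U = []}    {[]}    refl = []
⊕⇒≤ {U = x ∷ U} {y ∷ V} refl = ℕ.m≤m+n x y ∷ ⊕⇒≤ refl

∈⇒↭ : ∀ {A : Set} {x : A} {xs} → x ∈ xs → ∃[ ys ] xs ↭ x ∷ ys
∈⇒↭ x∈xs with ys , zs , refl ← ∈-∃++ x∈xs = ys List.++ zs , shift _ ys zs

Unique-resp-↭ : ∀ {A : Set} {I J : List A} → I ↭ J → Unique I → Unique J
Unique-resp-↭ {A} p = Permutationₛ.Unique-resp-↭ (setoid A) (↭⇒↭ₛ p)

lookup≢0⇒∈ : ∀ {n} {i : Fin n} I → lookup ⟦ I ⟧ i ≢ 0 → i ∈ I
lookup≢0⇒∈ {i = i} [] ≢0 = contradiction (lookup-𝟎 i) ≢0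
lookup≢0⇒∈ {i = i} (j ∷ I) ≢0 with i Fin.≟ j
... | yes refl = here refl
... | no  i≢j  = there (lookup≢0⇒∈ I λ eq → ≢0
  (trans (lookup-⊕ i (e j) ⟦ I ⟧) (cong₂ ℕ._+_ (lookup-e-≢ (i≢j ∘ sym)) eq)))

lookup-e⊕≢0 : ∀ {n} (i : Fin n) V → lookup (e i ⊕ V) i ≢ 0
lookup-e⊕≢0 i V eq with () ← trans (sym (trans (lookup-⊕ i (e i) V)
  (cong (ℕ._+ lookup V i) (Vec.lookup∘updateAt i 𝟎)))) eq

-- Turns an equation of vectors back into one of lists: `i` has nonzero exponent in `⟦ I ⟧`, so it
-- occurs in `I` and can be moved to the front.
e⊕-↭ : ∀ {n} {i : Fin n} {V} I → e i ⊕ V ≡ ⟦ I ⟧ → ∃[ J ] I ↭ i ∷ J × V ≡ ⟦ J ⟧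
e⊕-↭ {i = i} {V} I eq
  with J , p ← ∈⇒↭ (lookup≢0⇒∈ I (subst (λ W → lookup W i ≢ 0) eq (lookup-e⊕≢0 i V))) =
  J , p , ⊕-cancelˡ (e i) (trans eq (⟦⟧-↭ p))

-- The list of variables handed to the ring solver must not use overloaded constructors.
pattern ⟨_⨾_⟩ p q = p List.∷ q List.∷ List.[]
pattern ⟨_⨾_⨾_⟩ p q r = p List.∷ q List.∷ r List.∷ List.[]

AllPairs-lookup : ∀ {A : Set} {R : A → A → Set} {xs} → AllPairs R xs →
                  ∀ {i j} → i Fin.< j → R (List.lookup xs i) (List.lookup xs j)
AllPairs-lookup {xs = _ ∷ xs} (rs ∷ _)  {zero}  {suc j} _         =
  All.lookup rs (∈-lookup j)
AllPairs-lookup (_ ∷ rss) {suc i} {suc j} (s≤s i<j) = AllPairs-lookup rss i<j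

-- Integers modulo m and pairwise incongruent values

module Residues (m : ℕ) .{{_ : ℕ.NonZero m}} where

  open import Data.Integer using (_+_; _-_; _*_; -_)

  D : ℤ → Set
  D z = + m ∣ z

  -- A record rather than a function type, so that z can be inferred.
  record NZ (z : ℤ) : Set where
    constructor nz
    field ∤ : ¬ D z

  open NZ public

  infix 4 _≈_ _≉_

  _≈_ _≉_ : ℤ → ℤ → Set
  u ≈ v = D (u - v)
  u ≉ v = NZ (u - v)

  D0 : D 0ℤ
  D0 = divides 0ℤ refl

  nz⁺ : ∀ {p r} → NZ p → p ≡ r → NZ r
  nz⁺ np refl = np

  nz⁻ : ∀ {p r} → NZ p → - p ≡ r → NZ r
  nz⁻ {p} (nz p∤) refl = nz λ d → p∤ (subst D (ℤ.neg-involutive p) (∣m⇒∣-m d))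

  nz-mod : ∀ {p q r} → NZ p → D q → p + q ≡ r → NZ r
  nz-mod (nz p∤) dq refl = nz λ d → p∤ (∣m+n∣n⇒∣m d dq)

  ≉-sym : ∀ u v → u ≉ v → v ≉ u
  ≉-sym u v h = nz⁻ h (ℤ-Solver.solve ⟨ u ⨾ v ⟩)

  ≈-sym : ∀ u v → u ≈ v → v ≈ u
  ≈-sym u v d = subst D (negate u v) (∣m⇒∣-m d)
    where
    negate : ∀ u v → - (u - v) ≡ v - u
    negate = ℤ-Solver.solve-∀

  -- Pigeonhole on the remainders.
  apart⇒length≤m : ∀ {vs} → AllPairs _≉_ vs → length vs ≤ m
  apart⇒length≤m {vs} apart with length vs ℕ.≤? m
  ... | yes ≤m = ≤m
  ... | no  ≰m with i , j , i<j , eq ← Fin.pigeonhole (ℕ.≰⇒> ≰m)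
                     (λ i → Fin.fromℕ< (n%ℕd<d (List.lookup vs i) m)) =
    contradiction
      (same-remainder (List.lookup vs i) (List.lookup vs j) (Fin.fromℕ<-injective _ _ _ _ eq))
      (∤ (AllPairs-lookup apart i<j))
    where
    cancel : ∀ r p q d → p * d - q * d ≡ (r + p * d) - (r + q * d)
    cancel = ℤ-Solver.solve-∀
    same-remainder : ∀ u v → u %ℕ m ≡ v %ℕ m → u ≈ v
    same-remainder u v eq =
      subst₂ (λ u v → D (u - v)) (sym (a≡a%ℕn+[a/ℕn]*n u m))
        (trans (cong (λ r → + r + (v /ℕ m) * + m) eq) (sym (a≡a%ℕn+[a/ℕn]*n v m)))
        (subst D (cancel (+ (u %ℕ m)) (u /ℕ m) (v /ℕ m) (+ m))
          (∣m∣n⇒∣m-n (divides (u /ℕ m) refl) (divides (v /ℕ m) refl)))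

  -- `p` itself is left out, since it may be congruent to `q + r`. Every difference of two listed
  -- values is, up to sign, one of the quantities assumed nonzero.
  six-apart : ∀ p q r → NZ p → NZ q → NZ r → p ≉ q → p ≉ r → q ≉ r →
              NZ (p + q) → NZ (p + r) → p + q ≉ r → p + r ≉ q →
              AllPairs _≉_ (q ∷ r ∷ p + q ∷ p + r ∷ q + r ∷ p + (q + r) ∷ [])
  six-apart p q r p≉0 q≉0 r≉0 p≉q p≉r q≉r p+q≉0 p+r≉0 p+q≉r p+r≉q =
      (q≉r ∷ nz⁻ p≉0 (ℤ-Solver.solve ⟨ p ⨾ q ⟩) ∷ ≉-sym (p + r) q p+r≉q
        ∷ nz⁻ r≉0 (ℤ-Solver.solve ⟨ q ⨾ r ⟩) ∷ nz⁻ p+r≉0 (ℤ-Solver.solve ⟨ p ⨾ q ⨾ r ⟩) ∷ [])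
    ∷ (≉-sym (p + q) r p+q≉r ∷ nz⁻ p≉0 (ℤ-Solver.solve ⟨ p ⨾ r ⟩) ∷ nz⁻ q≉0 (ℤ-Solver.solve ⟨ q ⨾ r ⟩)
        ∷ nz⁻ p+q≉0 (ℤ-Solver.solve ⟨ p ⨾ q ⨾ r ⟩) ∷ [])
    ∷ (nz⁺ q≉r (ℤ-Solver.solve ⟨ p ⨾ q ⨾ r ⟩) ∷ nz⁺ p≉r (ℤ-Solver.solve ⟨ p ⨾ q ⨾ r ⟩)
        ∷ nz⁻ r≉0 (ℤ-Solver.solve ⟨ p ⨾ q ⨾ r ⟩) ∷ [])
    ∷ (nz⁺ p≉q (ℤ-Solver.solve ⟨ p ⨾ q ⨾ r ⟩) ∷ nz⁻ q≉0 (ℤ-Solver.solve ⟨ p ⨾ q ⨾ r ⟩) ∷ [])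
    ∷ (nz⁻ p≉0 (ℤ-Solver.solve ⟨ p ⨾ q ⨾ r ⟩) ∷ [])
    ∷ [] ∷ []

  three-apart : ∀ p q → NZ p → NZ q → p ≉ q → AllPairs _≉_ (p ∷ q ∷ p + q ∷ [])
  three-apart p q p≉0 q≉0 p≉q =
      (p≉q ∷ nz⁻ q≉0 (ℤ-Solver.solve ⟨ p ⨾ q ⟩) ∷ [])
    ∷ (nz⁻ p≉0 (ℤ-Solver.solve ⟨ p ⨾ q ⟩) ∷ []) ∷ [] ∷ []

  -- The one difference not covered directly is `r - (q + q)`, which `p + q ≈ r` turns into `p - q`.
  five-apart : ∀ p q r → NZ q → NZ r → NZ (q + q) → NZ (q + r) → p ≉ q → q ≉ r → p + q ≈ r →
               AllPairs _≉_ (q ∷ r ∷ q + q ∷ q + r ∷ q + (q + r) ∷ [])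
  five-apart p q r q≉0 r≉0 2q≉0 q+r≉0 p≉q q≉r p+q≈r =
      (q≉r ∷ nz⁻ q≉0 (ℤ-Solver.solve ⟨ q ⨾ r ⟩) ∷ nz⁻ r≉0 (ℤ-Solver.solve ⟨ q ⨾ r ⟩)
        ∷ nz⁻ q+r≉0 (ℤ-Solver.solve ⟨ q ⨾ r ⟩) ∷ [])
    ∷ (nz-mod p≉q (≈-sym (p + q) r p+q≈r) (ℤ-Solver.solve ⟨ p ⨾ q ⨾ r ⟩)
        ∷ nz⁻ q≉0 (ℤ-Solver.solve ⟨ q ⨾ r ⟩) ∷ nz⁻ 2q≉0 (ℤ-Solver.solve ⟨ q ⨾ r ⟩) ∷ [])
    ∷ (nz⁺ q≉r (ℤ-Solver.solve ⟨ q ⨾ r ⟩) ∷ nz⁻ r≉0 (ℤ-Solver.solve ⟨ q ⨾ r ⟩) ∷ [])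
    ∷ (nz⁻ q≉0 (ℤ-Solver.solve ⟨ q ⨾ r ⟩) ∷ [])
    ∷ [] ∷ []

-- Sums of parts of an exponent vector modulo m = n + 1

module SubsetSums (n : ℕ) where

  open import Data.Integer using (_+_; _-_; -_)
  open Residues (suc n) public

  w : Exponents n → ℤ
  w V = + weight V

  x : Fin n → ℤ
  x i = + suc (toℕ i)

  w-⊕ : ∀ U V → w (U ⊕ V) ≡ w U + w V
  w-⊕ U V = cong +_ (linear-⊕ (suc ∘ toℕ) U V)

  w-𝟎 : w 𝟎 ≡ 0ℤ
  w-𝟎 = cong +_ (linear-𝟎 {n} (suc ∘ toℕ))

  w-e : ∀ i → w (e i) ≡ x i
  w-e i = cong +_ (linear-e (suc ∘ toℕ) i)

  -- Singletons have their own clause so that no final `0ℤ` appears and sums of explicit lists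
  -- unfold to the expressions of `six-apart` and `five-apart`.
  Σx : List (Fin n) → ℤ
  Σx []          = 0ℤ
  Σx (i ∷ [])    = x i
  Σx (i ∷ j ∷ I) = x i + Σx (j ∷ I)

  w-⟦⟧ : ∀ I → w ⟦ I ⟧ ≡ Σx I
  w-⟦⟧ []          = w-𝟎
  w-⟦⟧ (i ∷ [])    = trans (cong w (⊕.identityʳ (e i))) (w-e i)
  w-⟦⟧ (i ∷ j ∷ I) = trans (w-⊕ (e i) ⟦ j ∷ I ⟧) (cong₂ _+_ (w-e i) (w-⟦⟧ (j ∷ I)))

  -- The values lie between 1 and n, so their differences are less than m in absolute value.
  x-injective : ∀ {i j} → x i ≈ x j → i ≡ j
  x-injective {i} {j} d = Fin.toℕ-injective (ℕ.suc-injective (close (∣⇒∣ᵤ d)))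
    where
    close : suc n ℕ.∣ ℤ.∣ x i - x j ∣ → suc (toℕ i) ≡ suc (toℕ j)
    close d with ℤ.∣ x i - x j ∣ in eq
    ... | zero  = ℤ.+-injective (ℤ.i-j≡0⇒i≡j (x i) (x j) (ℤ.∣i∣≡0⇒i≡0 eq))
    ... | suc k = contradiction (ℕ.∣⇒≤ d) (ℕ.<⇒≱ (subst (ℕ._< suc n) eq bound))
      where
      bound : ℤ.∣ x i - x j ∣ < suc n
      bound = ℕ.≤-<-trans (ℤ.∣m⊝n∣≤m⊔n (suc (toℕ i)) (suc (toℕ j)))
        (s≤s (ℕ.⊔-lub (Fin.toℕ<n i) (Fin.toℕ<n j)))

  -- Since `0 < 2 x i < 2m`, a double divisible by m equals m. Hence at most one index has a residue
  -- of order two.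
  2x-injective : ∀ {i j} → D (x i + x i) → D (x j + x j) → i ≡ j
  2x-injective {i} {j} di dj = Fin.toℕ-injective (ℕ.suc-injective
    (ℕ.*-cancelˡ-≡ _ _ 2 (trans (double i di) (sym (double j dj)))))
    where
    double : ∀ i → D (x i + x i) → 2 ℕ.* suc (toℕ i) ≡ suc n
    double i d with ∣⇒∣ᵤ d
    ... | ℕ.divides 1 eq = trans (cong (suc (toℕ i) ℕ.+_) (ℕ.+-identityʳ _))
      (trans eq (ℕ.+-identityʳ (suc n)))
    ... | ℕ.divides (suc (suc q)) eq = contradiction eq (ℕ.<⇒≢ (begin-strict
      suc (toℕ i) ℕ.+ suc (toℕ i) <⟨ ℕ.+-mono-< (s≤s (Fin.toℕ<n i)) (s≤s (Fin.toℕ<n i)) ⟩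
      suc n ℕ.+ suc n             ≤⟨ ℕ.+-monoʳ-≤ (suc n) (ℕ.m≤m+n (suc n) _) ⟩
      suc (suc q) ℕ.* suc n       ∎))
      where open ℕ.≤-Reasoning

  x≉ : ∀ {i j} → i ≢ j → x i ≉ x j
  x≉ i≢j = nz (i≢j ∘ x-injective)

  ZeroSumFree : Exponents n → Set
  ZeroSumFree X = ∀ {U V} → U ⊕ V ≡ X → U ≢ 𝟎 → NZ (w U)

  Minimal : Exponents n → Set
  Minimal ν = ∀ {U V} → U ⊕ V ≡ ν → U ≢ 𝟎 → V ≢ 𝟎 → NZ (w U)

  minimal⇒zeroSumFree : ∀ {ν X R} → Minimal ν → X ⊕ R ≡ ν → R ≢ 𝟎 → ZeroSumFree X
  minimal⇒zeroSumFree {R = R} min refl R≢𝟎 {U} {V} refl U≢𝟎 =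
    min (sym (⊕.assoc U V R)) U≢𝟎 (⊕-≢𝟎ʳ R≢𝟎)

  zeroSumFree-⊕ : ∀ {X Y Z} → Y ⊕ Z ≡ X → ZeroSumFree X → ZeroSumFree Y
  zeroSumFree-⊕ {Z = Z} refl zsf {U} {V} refl = zsf (sym (⊕.assoc U V Z))

  ⊆⇒⊕ : ∀ {J I : List (Fin n)} → J ⊆ I → ∃[ V ] ⟦ J ⟧ ⊕ V ≡ ⟦ I ⟧
  ⊆⇒⊕ []         = 𝟎 , ⊕.identityˡ 𝟎
  ⊆⇒⊕ {J} (i ∷ʳ p) with V , eq ← ⊆⇒⊕ p = e i ⊕ V ,
    trans (solve 3 (λ a b c → a ⊕′ b ⊕′ c ⊜ b ⊕′ a ⊕′ c) refl ⟦ J ⟧ (e i) V) (cong (e i ⊕_) eq)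
  ⊆⇒⊕ {i ∷ J} (refl ∷ p) with V , eq ← ⊆⇒⊕ p = V , trans (⊕.assoc (e i) ⟦ J ⟧ V) (cong (e i ⊕_) eq)

  Σx≉0 : ∀ {I j J} → ZeroSumFree ⟦ I ⟧ → j ∷ J ⊆ I → NZ (Σx (j ∷ J))
  Σx≉0 {j = j} {J} zsf sub = nz⁺ (zsf (proj₂ (⊆⇒⊕ sub)) (⊕-≢𝟎ˡ (e≢𝟎 j))) (w-⟦⟧ (j ∷ J))

  -- Counting incongruent sums block by block

  IsSum : Exponents n → ℤ → Set
  IsSum X v = ∃₂ λ U V → U ⊕ V ≡ X × U ≢ 𝟎 × w U ≡ v

  Σx-isSum : ∀ {I j J} → j ∷ J ⊆ I → IsSum ⟦ I ⟧ (Σx (j ∷ J))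
  Σx-isSum {j = j} {J} sub with V , eq ← ⊆⇒⊕ sub =
    ⟦ j ∷ J ⟧ , V , eq , ⊕-≢𝟎ˡ (e≢𝟎 j) , w-⟦⟧ (j ∷ J)

  record Spread (X : Exponents n) (k : ℕ) : Set where
    field
      values : List ℤ
      size   : length values ≡ k
      apart  : AllPairs _≉_ values
      sums   : All (IsSum X) values

  open Spread

  spread⇒≤ : ∀ {X k} → Spread X k → k ≤ suc n
  spread⇒≤ s = subst (_≤ suc n) (size s) (apart⇒length≤m (apart s))

  -- Sums of `X` are kept and sums of `Y` are shifted by `w X`. If `w U ≈ w X + w V`, with `U′` the
  -- rest of `X`, then `U′ ⊕ V` has sum zero; it is nonempty because of `V` and proper because it
  -- omits `U`.
  spread-⊕ : ∀ {ν X Y R j k} → Minimal ν → (X ⊕ Y) ⊕ R ≡ ν →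
             Spread X j → Spread Y k → Spread (X ⊕ Y) (j ℕ.+ k)
  spread-⊕ {ν} {X} {Y} {R} min eq s t = record
    { values = values s ++ map (λ v → w X + v) (values t)
    ; size   = trans (length-++ (values s))
                 (cong₂ ℕ._+_ (size s) (trans (length-map _ (values t)) (size t)))
    ; apart  = AllPairs.++⁺ (apart s)
                 (AllPairs.map⁺ (AllPairs.map (λ {u v} h → nz⁺ h (translate (w X) u v)) (apart t)))
                 (All.map (λ su → All.map⁺ (All.map (crossing su) (sums t))) (sums s))
    ; sums   = All.++⁺ (All.map extendʳ (sums s)) (All.map⁺ (All.map extendˡ (sums t)))
    }
    where
    translate : ∀ c u v → u - v ≡ (c + u) - (c + v)
    translate = ℤ-Solver.solve-∀
    difference : ∀ u u′ v → - (u′ + v) ≡ u - ((u + u′) + v)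
    difference = ℤ-Solver.solve-∀
    extendʳ : ∀ {u} → IsSum X u → IsSum (X ⊕ Y) u
    extendʳ (U , V , refl , U≢𝟎 , wU) = U , V ⊕ Y , sym (⊕.assoc U V Y) , U≢𝟎 , wU
    extendˡ : ∀ {v} → IsSum Y v → IsSum (X ⊕ Y) (w X + v)
    extendˡ (U , V , refl , U≢𝟎 , refl) = X ⊕ U , V , ⊕.assoc X U V , ⊕-≢𝟎ʳ U≢𝟎 , w-⊕ X U
    crossing : ∀ {u v} → IsSum X u → IsSum Y v → u ≉ w X + v
    crossing (U , U′ , refl , U≢𝟎 , refl) (V , V′ , refl , V≢𝟎 , refl) =
      nz⁻ (min {U′ ⊕ V} {U ⊕ V′ ⊕ R}
             (trans (solve 5 (λ a b c d r → (a ⊕′ b) ⊕′ c ⊕′ d ⊕′ r ⊜ ((c ⊕′ a) ⊕′ b ⊕′ d) ⊕′ r)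
                       refl U′ V U V′ R) eq)
             (⊕-≢𝟎ʳ V≢𝟎) (⊕-≢𝟎ˡ U≢𝟎))
          (begin
            - w (U′ ⊕ V)                  ≡⟨ cong -_ (w-⊕ U′ V) ⟩
            - (w U′ + w V)                ≡⟨ difference (w U) (w U′) (w V) ⟩
            w U - ((w U + w U′) + w V)    ≡⟨ cong (λ z → w U - (z + w V)) (w-⊕ U U′) ⟨
            w U - (w (U ⊕ U′) + w V)      ∎)
      where open ≡-Reasoning

  spread-e : ∀ i → Spread (e i) 1
  spread-e i = record
    { values = x i ∷ []
    ; size   = refl
    ; apart  = [] ∷ []
    ; sums   = (e i , 𝟎 , ⊕.identityʳ (e i) , e≢𝟎 i , w-e i) ∷ []
    }

  spread-𝟎 : ∀ {X} → Spread X 0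
  spread-𝟎 = record { values = [] ; size = refl ; apart = [] ; sums = [] }

  -- Each element is a block of its own; the values are the successive partial sums.
  spread-⟦⟧ : ∀ {ν R} I → Minimal ν → ⟦ I ⟧ ⊕ R ≡ ν → Spread ⟦ I ⟧ (length I)
  spread-⟦⟧ []      min eq = spread-𝟎
  spread-⟦⟧ {R = R} (i ∷ I) min eq = spread-⊕ min eq (spread-e i)
    (spread-⟦⟧ {R = e i ⊕ R} I min
      (trans (solve 3 (λ a b c → b ⊕′ a ⊕′ c ⊜ (a ⊕′ b) ⊕′ c) refl (e i) ⟦ I ⟧ R) eq))

  -- After the block `X` every remaining element adds one value, so the excess `h` persists until
  -- all of `ν` is used up, and there are at most m residues.
  spread⇒deg+h≤m : ∀ {ν X R h} → Minimal ν → X ⊕ R ≡ ν → Spread X (deg X ℕ.+ h) →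
                   deg ν ℕ.+ h ≤ suc n
  spread⇒deg+h≤m {ν} {X} {R} {h} min eq s with L , refl ← ⟦⟧-surjective R =
    subst (_≤ suc n) count (spread⇒≤ (spread-⊕ {R = 𝟎} min
      (trans (⊕.identityʳ _) eq) s (spread-⟦⟧ L min (trans (⊕.comm ⟦ L ⟧ X) eq))))
    where
    open ≡-Reasoning
    count : deg X ℕ.+ h ℕ.+ length L ≡ deg ν ℕ.+ h
    count = begin
      deg X ℕ.+ h ℕ.+ length L     ≡⟨ ℕ.+-assoc (deg X) h _ ⟩
      deg X ℕ.+ (h ℕ.+ length L)   ≡⟨ cong (deg X ℕ.+_) (ℕ.+-comm h _) ⟩
      deg X ℕ.+ (length L ℕ.+ h)   ≡⟨ ℕ.+-assoc (deg X) _ h ⟨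
      deg X ℕ.+ length L ℕ.+ h     ≡⟨ cong (λ d → deg X ℕ.+ d ℕ.+ h) (deg-⟦⟧ L) ⟨
      deg X ℕ.+ deg ⟦ L ⟧ ℕ.+ h    ≡⟨ cong (ℕ._+ h) (deg-⊕ X ⟦ L ⟧) ⟨
      deg (X ⊕ ⟦ L ⟧) ℕ.+ h        ≡⟨ cong (λ V → deg V ℕ.+ h) eq ⟩
      deg ν ℕ.+ h                  ∎

  -- Six sums from three elements

  Collision : Fin n → Fin n → Fin n → Set
  Collision a b c = x a + x b ≈ x c

  six-sums : ∀ {a b c} → a ≢ b → a ≢ c → b ≢ c → ZeroSumFree ⟦ a ∷ b ∷ c ∷ [] ⟧ →
             ¬ Collision a b c → ¬ Collision a c b → Spread ⟦ a ∷ b ∷ c ∷ [] ⟧ 6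
  six-sums {a} {b} {c} a≢b a≢c b≢c zsf ¬abc ¬acb = record
    { values = _
    ; size   = refl
    ; apart  = six-apart (x a) (x b) (x c)
                 (Σx≉0 zsf [a]) (Σx≉0 zsf [b]) (Σx≉0 zsf [c]) (x≉ a≢b) (x≉ a≢c) (x≉ b≢c)
                 (Σx≉0 zsf [ab]) (Σx≉0 zsf [ac]) (nz ¬abc) (nz ¬acb)
    ; sums   = Σx-isSum [b] ∷ Σx-isSum [c] ∷ Σx-isSum [ab] ∷ Σx-isSum [ac] ∷ Σx-isSum [bc]
                 ∷ Σx-isSum [abc] ∷ []
    }
    where
    [a] : a ∷ [] ⊆ a ∷ b ∷ c ∷ []
    [a] = refl ∷ b ∷ʳ c ∷ʳ []
    [b] : b ∷ [] ⊆ a ∷ b ∷ c ∷ []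
    [b] = a ∷ʳ refl ∷ c ∷ʳ []
    [c] : c ∷ [] ⊆ a ∷ b ∷ c ∷ []
    [c] = a ∷ʳ b ∷ʳ refl ∷ []
    [ab] : a ∷ b ∷ [] ⊆ a ∷ b ∷ c ∷ []
    [ab] = refl ∷ refl ∷ c ∷ʳ []
    [ac] : a ∷ c ∷ [] ⊆ a ∷ b ∷ c ∷ []
    [ac] = refl ∷ b ∷ʳ refl ∷ []
    [bc] : b ∷ c ∷ [] ⊆ a ∷ b ∷ c ∷ []
    [bc] = a ∷ʳ refl ∷ refl ∷ []
    [abc] : a ∷ b ∷ c ∷ [] ⊆ a ∷ b ∷ c ∷ []
    [abc] = refl ∷ refl ∷ refl ∷ []

  Degenerate : List (Fin n) → Set
  Degenerate I = ∃[ a ] ∃₂ λ b c → I ↭ a ∷ b ∷ c ∷ [] × D (x a + x a) × x a + x b ≈ x c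

  -- `six-sums` tolerates one collision, provided the element that is the sum of the other two comes
  -- first. Any two collisions share a summand `i`, and adding them gives `2i ≈ 0`.
  six-sums-or-degenerate : ∀ I → length I ≡ 3 → Unique I → ZeroSumFree ⟦ I ⟧ →
                           Spread ⟦ I ⟧ 6 ⊎ Degenerate I
  six-sums-or-degenerate I@(a ∷ b ∷ c ∷ []) refl ((a≢b ∷ a≢c ∷ []) ∷ (b≢c ∷ []) ∷ _) zsf =
    cases (+ suc n ∣? x a + x b - x c) (+ suc n ∣? x a + x c - x b) (+ suc n ∣? x b + x c - x a)
    where
    two-collisions : ∀ p q r → (p + q - r) + (p + r - q) ≡ p + p
    two-collisions = ℤ-Solver.solve-∀
    comm : ∀ i j k → Collision i j k → Collision j i k
    comm i j k = subst (_≈ x k) (ℤ.+-comm (x i) (x j))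
    degenerate : ∀ {i j k} → I ↭ i ∷ j ∷ k ∷ [] → Collision i j k → Collision i k j → Degenerate I
    degenerate {i} {j} {k} p d d′ =
      i , j , k , p , subst D (two-collisions (x i) (x j) (x k)) (∣m∣n⇒∣m+n d d′) , d
    permuted : ∀ {i j k} → I ↭ i ∷ j ∷ k ∷ [] → i ≢ j → i ≢ k → j ≢ k →
               ¬ Collision i j k → ¬ Collision i k j → Spread ⟦ I ⟧ 6
    permuted p i≢j i≢k j≢k h h′ = subst (λ X → Spread X 6) (sym (⟦⟧-↭ p))
      (six-sums i≢j i≢k j≢k (subst ZeroSumFree (⟦⟧-↭ p) zsf) h h′)
    bac : I ↭ b ∷ a ∷ c ∷ []
    bac = swap a b refl
    cab : I ↭ c ∷ a ∷ b ∷ []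
    cab = shift c (a ∷ b ∷ []) []
    cases : Dec (Collision a b c) → Dec (Collision a c b) → Dec (Collision b c a) →
            Spread ⟦ I ⟧ 6 ⊎ Degenerate I
    cases (yes abc) (yes acb) _         = inj₂ (degenerate ↭-refl abc acb)
    cases (yes abc) (no ¬acb) (yes bca) = inj₂ (degenerate bac (comm a b c abc) bca)
    cases (yes abc) (no ¬acb) (no ¬bca) =
      inj₁ (permuted cab (a≢c ∘ sym) (b≢c ∘ sym) a≢b (¬acb ∘ comm c a b) (¬bca ∘ comm c b a))
    cases (no ¬abc) (yes acb) (yes bca) = inj₂ (degenerate cab (comm a c b acb) (comm b c a bca))
    cases (no ¬abc) (yes acb) (no ¬bca) =
      inj₁ (permuted bac (a≢b ∘ sym) b≢c a≢c (¬abc ∘ comm b a c) ¬bca)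
    cases (no ¬abc) (no ¬acb) _         = inj₁ (permuted ↭-refl a≢b a≢c b≢c ¬abc ¬acb)

  -- Removing an element at the cost of two sums

  NewSum : Exponents n → Exponents n → ℤ → Set
  NewSum X Y v = IsSum X v × v ≉ w X × (∀ {U V} → U ⊕ V ≡ Y → v ≉ w U)

  -- The values gained are `v` and the total `w X`; the latter differs from a sum `w U` of `Y` by
  -- the sum of `e g ⊕ V`, which contains `g` and so is nonempty.
  spread-extend : ∀ {X Y g v k} → e g ⊕ Y ≡ X → ZeroSumFree X → NewSum X Y v →
                  Spread Y k → Spread X (2 ℕ.+ k)
  spread-extend {X} {Y} {g} {v} refl zsf (v-sum , v≉wX , v-new) s = record
    { values = w X ∷ v ∷ values s
    ; size   = cong (2 ℕ.+_) (size s)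
    ; apart  = (≉-sym v (w X) v≉wX ∷ All.map total-new (sums s)) ∷ All.map sum-new (sums s) ∷ apart s
    ; sums   = (X , 𝟎 , ⊕.identityʳ X , ⊕-≢𝟎ˡ (e≢𝟎 g) , refl) ∷ v-sum ∷ All.map extend (sums s)
    }
    where
    extend : ∀ {u} → IsSum Y u → IsSum X u
    extend (U , V , refl , U≢𝟎 , wU) = U , e g ⊕ V ,
      solve 3 (λ a b c → a ⊕′ b ⊕′ c ⊜ b ⊕′ a ⊕′ c) refl U (e g) V , U≢𝟎 , wU
    sum-new : ∀ {u} → IsSum Y u → v ≉ u
    sum-new (U , V , eq , _ , refl) = v-new eq
    cancel : ∀ p q → p ≡ (q + p) - q
    cancel = ℤ-Solver.solve-∀
    total-new : ∀ {u} → IsSum Y u → w X ≉ u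
    total-new (U , V , refl , _ , refl) = nz⁺ (zsf {e g ⊕ V} {U}
      (solve 3 (λ a b c → (b ⊕′ c) ⊕′ a ⊜ b ⊕′ a ⊕′ c) refl U (e g) V) (⊕-≢𝟎ˡ (e≢𝟎 g)))
      (trans (cancel (w (e g ⊕ V)) (w U)) (cong (_- w U) (trans (sym (w-⊕ U (e g ⊕ V)))
        (cong w (solve 3 (λ a b c → a ⊕′ b ⊕′ c ⊜ b ⊕′ a ⊕′ c) refl U (e g) V)))))

  -- As `x c` is its own negative, `x c ≈ w U` would give the part `e c ⊕ U` sum zero; `x c ≈ w X`
  -- would make `w Y` vanish.
  involution-new : ∀ {X Y c} → e c ⊕ Y ≡ X → ZeroSumFree X → D (x c + x c) → Y ≢ 𝟎 →
                   NewSum X Y (x c)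
  involution-new {X} {Y} {c} refl zsf 2c≈0 Y≢𝟎 =
    (e c , Y , refl , e≢𝟎 c , w-e c)
    , nz⁻ (zsf {Y} {e c} (⊕.comm Y (e c)) Y≢𝟎)
        (trans (drop (x c) (w Y)) (cong (λ z → x c - z) (sym (trans (w-⊕ (e c) Y) (cong (_+ w Y) (w-e c))))))
    , λ { {U} {V} refl → nz-mod
        (nz⁻ (nz⁺ (zsf {e c ⊕ U} {V} (⊕.assoc (e c) U V) (⊕-≢𝟎ˡ (e≢𝟎 c)))
               (trans (w-⊕ (e c) U) (cong (_+ w U) (w-e c)))) refl)
        2c≈0 (negate (x c) (w U)) }
    where
    drop : ∀ p q → - q ≡ p - (p + q)
    drop = ℤ-Solver.solve-∀
    negate : ∀ p q → - (p + q) + (p + p) ≡ p - q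
    negate = ℤ-Solver.solve-∀

  -- If no removal of a g ∈ X loses two sums, every sum of X other than w X is a sum of X − g, for
  -- all g. This set A is then closed under v ↦ w X − g − v and, for v ≉ 0, under v ↦ v − g. For
  -- g ≉ t it contains in turn 0, g − t, g − 2t and −t, and the last makes a sum of X vanish.
  exists-new : ∀ {X Y Z g t} → ZeroSumFree X → e g ⊕ Y ≡ X → e t ⊕ Z ≡ X → g ≢ t →
               ¬ ¬ (∃[ h ] ∃₂ λ W v → e h ⊕ W ≡ X × NewSum X W v)
  exists-new {X} {Y} {Z} {g} {t} zsf eg et g≢t none =
    -- The residue `- x t` is also attained by a part `U′` of `Z`, and adding `t` to `U′` gives a
    -- nonempty part of sum zero.
    A[-t] λ (U , V , eq , V≢𝟎 , d) → avoid et eq V≢𝟎 λ (U′ , V′ , eq′ , d′) →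
      ∤ (zsf {e t ⊕ U′} {V′} (trans (⊕.assoc (e t) U′ V′) (trans (cong (e t ⊕_) eq′) et))
          (⊕-≢𝟎ˡ (e≢𝟎 t)))
        (subst D (trans (vanish (x t) (w U) (w U′)) (sym (w-e⊕ t U′))) (∣m∣n⇒∣m+n d d′))
    where
    w-e⊕ : ∀ i V → w (e i ⊕ V) ≡ x i + w V
    w-e⊕ i V = trans (w-⊕ (e i) V) (cong (_+ w V) (w-e i))
    vanish : ∀ p u u′ → (u - - p) + (u′ - u) ≡ p + u′
    vanish = ℤ-Solver.solve-∀

    -- Residues of sums of proper, possibly empty, parts. Refuting newness only shows that a part
    -- with the same sum cannot fail to exist, hence the double negation; it is harmless, as the
    -- goal is `⊥`.
    A : ℤ → Set
    A v = ¬ ¬ (∃₂ λ U V → U ⊕ V ≡ X × V ≢ 𝟎 × w U ≈ v)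

    -- If no part of `W` had the sum of `U`, then `w U` would be new, against `none`; it differs
    -- from `w X` because `V` is nonempty.
    avoid : ∀ {i W U V} → e i ⊕ W ≡ X → U ⊕ V ≡ X → V ≢ 𝟎 →
            ¬ ¬ (∃₂ λ U′ V′ → U′ ⊕ V′ ≡ W × w U′ ≈ w U)
    avoid {i} {W} {U} {V} ei refl V≢𝟎 k = none
      (i , W , w U , ei , (U , V , refl , U≢𝟎 , refl)
      , nz⁻ (zsf (⊕.comm V U) V≢𝟎) (trans (drop (w U) (w V)) (cong (λ z → w U - z) (sym (w-⊕ U V))))
      , λ {U′} {V′} eq → nz λ d → k (U′ , V′ , eq , ≈-sym (w U) (w U′) d))
      where
      drop : ∀ p q → - q ≡ p - (p + q)
      drop = ℤ-Solver.solve-∀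
      U≢𝟎 : U ≢ 𝟎
      U≢𝟎 U≡𝟎 = k (U , W , trans (cong (_⊕ W) U≡𝟎) (⊕.identityˡ W) , subst D (sym (ℤ.+-inverseʳ (w U))) D0)

    -- Once `v` is the sum of a part of `W`, the complement in `W` has the required sum and is
    -- proper in `X` because it omits `i`.
    reflect : ∀ {i W v} → e i ⊕ W ≡ X → A v → A (w X - x i - v)
    reflect {i} {W} {v} ei a k = a λ (U , V , eq , V≢𝟎 , d) → avoid ei eq V≢𝟎 λ
      { (U′ , V′ , refl , d′) → k
        (V′ , e i ⊕ U′
        , trans (solve 3 (λ a b c → c ⊕′ b ⊕′ a ⊜ b ⊕′ a ⊕′ c) refl U′ (e i) V′) ei , ⊕-≢𝟎ˡ (e≢𝟎 i)
        , subst D (trans (complement (x i) v (w U) (w U′) (w V′))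
                    (cong (λ z → w V′ - (z - x i - v)) (trans (cong (λ z → x i + z) (sym (w-⊕ U′ V′)))
                      (trans (sym (w-e⊕ i (U′ ⊕ V′))) (cong w ei)))))
            (∣m⇒∣-m (∣m∣n⇒∣m+n d d′))) }
      where
      complement : ∀ p v u u′ v′ → - ((u - v) + (u′ - u)) ≡ v′ - ((p + (u′ + v′)) - p - v)
      complement = ℤ-Solver.solve-∀

    -- The complement of a part of sum `v` has sum `w X - v` and is proper because `v ≉ 0`;
    -- reflecting it gives `v - x i`.
    step : ∀ {i W v} → e i ⊕ W ≡ X → NZ v → A v → A (v - x i)
    step {i} {W} {v} ei v≉0 a = subst A (collapse (w X) (x i) v) (reflect ei λ k → a λ
      { (U , V , refl , V≢𝟎 , d) → k
        (V , U , ⊕.comm V U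
        , (λ U≡𝟎 → ∤ v≉0 (subst D (trans (cong (λ z → - (z - v)) (trans (cong w U≡𝟎) w-𝟎)) (zero-minus v))
            (∣m⇒∣-m d)))
        , subst D (trans (swap-sides (w U) (w V) v) (cong (λ z → w V - (z - v)) (sym (w-⊕ U V))))
            (∣m⇒∣-m d)) })
      where
      collapse : ∀ p q v → p - q - (p - v) ≡ v - q
      collapse = ℤ-Solver.solve-∀
      zero-minus : ∀ v → - (0ℤ - v) ≡ v
      zero-minus = ℤ-Solver.solve-∀
      swap-sides : ∀ u u′ v → - (u - v) ≡ u′ - ((u + u′) - v)
      swap-sides = ℤ-Solver.solve-∀

    A[0] : A 0ℤ
    A[0] k = k (𝟎 , X , ⊕.identityˡ X , subst (_≢ 𝟎) eg (⊕-≢𝟎ˡ (e≢𝟎 g))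
      , subst D (sym (trans (ℤ.+-identityʳ (w 𝟎)) w-𝟎)) D0)

    A[g-t] : A (x g - x t)
    A[g-t] = subst A (difference (w X) (x g) (x t)) (reflect et (reflect {v = 0ℤ} eg A[0]))
      where
      difference : ∀ p q r → p - r - (p - q - 0ℤ) ≡ q - r
      difference = ℤ-Solver.solve-∀

    A[-t] : A (- x t)
    A[-t] = subst A (descend (w X) (x g) (x t))
      -- Reflecting in `t` and then in `g` adds `x t - x g`, which takes `g - 2t` to `-t`.
      (reflect eg (reflect et (step et (x≉ g≢t) A[g-t])))
      where
      descend : ∀ p q r → p - q - (p - r - (q - r - r)) ≡ - r
      descend = ℤ-Solver.solve-∀

  -- Twice as many sums as elements in the support

  NonInvolution : Fin n → Set
  NonInvolution i = NZ (x i + x i)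

  -- `exists-new` removes elements at the cost of two sums each until three are left; there
  -- degeneracy would require an element of order two.
  spread-doubles : ∀ k I → length I ≡ 3 ℕ.+ k → Unique I → All NonInvolution I → ZeroSumFree ⟦ I ⟧ →
                   ¬ ¬ Spread ⟦ I ⟧ ((3 ℕ.+ k) ℕ.* 2)
  spread-doubles zero I len u ninv zsf none with six-sums-or-degenerate I len u zsf
  ... | inj₁ s = none s
  ... | inj₂ (a , b , c , p , 2a≈0 , _) with 2a≉0 ∷ _ ← All-resp-↭ p ninv = ∤ 2a≉0 2a≈0
  spread-doubles (suc k) I@(i ∷ j ∷ I′) len u@((i≢j ∷ _) ∷ _) ninv zsf none =
    exists-new zsf refl (solve 3 (λ a b c → b ⊕′ a ⊕′ c ⊜ a ⊕′ b ⊕′ c) refl (e i) (e j) ⟦ I′ ⟧) i≢j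
      λ (h , W , v , eq , new) → remove eq new (e⊕-↭ I eq)
    where
    remove : ∀ {h W v} → e h ⊕ W ≡ ⟦ I ⟧ → NewSum ⟦ I ⟧ W v → (∃[ J ] I ↭ h ∷ J × W ≡ ⟦ J ⟧) → ⊥
    remove {h} eq new (J , p , refl) with _ ∷ u′ ← Unique-resp-↭ p u | _ ∷ ninv′ ← All-resp-↭ p ninv =
      spread-doubles k J (ℕ.suc-injective (trans (sym (↭-length p)) len)) u′ ninv′
        (zeroSumFree-⊕ (trans (⊕.comm ⟦ J ⟧ (e h)) eq) zsf)
        (none ∘ spread-extend eq zsf new)

  split-involution : ∀ I → Unique I → All NonInvolution I ⊎
                     (∃₂ λ c J → I ↭ c ∷ J × D (x c + x c) × All NonInvolution J)
  split-involution []      _ = inj₁ []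
  split-involution (i ∷ I) (i∉I ∷ u) with + suc n ∣? x i + x i | split-involution I u
  ... | yes d | _ = inj₂ (i , I , refl , d , All.map (λ i≢j → nz (i≢j ∘ 2x-injective d)) i∉I)
  ... | no ¬d | inj₁ ninv = inj₁ (nz ¬d ∷ ninv)
  ... | no ¬d | inj₂ (c , J , p , d , ninv) =
    inj₂ (c , i ∷ J , ↭-trans (prep i p) (swap i c refl) , d , nz ¬d ∷ ninv)

  -- An element of order two is set aside and accounts for two sums by `involution-new`. Starting
  -- from four elements leaves the three that `spread-doubles` needs.
  spread-support : ∀ I → 4 ≤ length I → Unique I → ZeroSumFree ⟦ I ⟧ → ¬ ¬ Spread ⟦ I ⟧ (length I ℕ.* 2)
  spread-support I@(_ ∷ _ ∷ _ ∷ _ ∷ I₀) (s≤s (s≤s (s≤s (s≤s z≤n)))) u zsf none with split-involution I u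
  ... | inj₁ ninv = spread-doubles (suc (length I₀)) I refl u ninv zsf none
  ... | inj₂ (c , J , p , 2c≈0 , ninv) with _ ∷ u′ ← Unique-resp-↭ p u =
    spread-doubles (length I₀) J lenJ u′ ninv
      (zeroSumFree-⊕ (trans (⊕.comm ⟦ J ⟧ (e c)) (sym (⟦⟧-↭ p))) zsf)
      (none ∘ spread-extend (sym (⟦⟧-↭ p)) zsf (involution-new (sym (⟦⟧-↭ p)) zsf 2c≈0 ⟦J⟧≢𝟎))
    where
    lenJ : length J ≡ 3 ℕ.+ length I₀
    lenJ = ℕ.suc-injective (sym (↭-length p))
    ⟦J⟧≢𝟎 : ⟦ J ⟧ ≢ 𝟎
    ⟦J⟧≢𝟎 eq with () ← trans (sym lenJ) (trans (sym (deg-⟦⟧ J)) (trans (cong deg eq) (deg-𝟎 n)))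

  -- The support and its negatives

  x≉0 : ∀ i → NZ (x i)
  x≉0 i = nz λ d → contradiction (ℕ.∣⇒≤ (∣⇒∣ᵤ d)) (ℕ.<⇒≱ (s≤s (Fin.toℕ<n i)))

  -- A third element of `I` makes the pair a proper part.
  pair≉0 : ∀ {ν R I i j} → Minimal ν → ⟦ I ⟧ ⊕ R ≡ ν → 3 ≤ length I →
           i ∈ I → j ∈ I → i ≢ j → NZ (x i + x j)
  pair≉0 {R = R} {I} {i} {j} min refl 3≤I i∈I j∈I i≢j with ∈⇒↭ i∈I
  ... | J , p with ∈-resp-↭ p j∈I
  ...   | here j≡i  = contradiction (sym j≡i) i≢j
  ...   | there j∈J with ∈⇒↭ j∈J
  ...     | [] , q = contradiction (subst (3 ≤_) (trans (↭-length p) (cong suc (↭-length q))) 3≤I)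
                     λ { (s≤s (s≤s ())) }
  ...     | K@(k ∷ _) , q = nz⁺ (min {⟦ i ∷ j ∷ [] ⟧} {⟦ K ⟧ ⊕ R} split
                              (⊕-≢𝟎ˡ (e≢𝟎 i)) (⊕-≢𝟎ˡ (⊕-≢𝟎ˡ (e≢𝟎 k))))
                            (w-⟦⟧ (i ∷ j ∷ []))
    where
    split : ⟦ i ∷ j ∷ [] ⟧ ⊕ ⟦ K ⟧ ⊕ R ≡ ⟦ I ⟧ ⊕ R
    split = trans (sym (⊕.assoc ⟦ i ∷ j ∷ [] ⟧ ⟦ K ⟧ R)) (cong (_⊕ R)
      (trans (sym (⟦⟧-++ (i ∷ j ∷ []) K)) (sym (⟦⟧-↭ (↭-trans p (prep i q))))))

  signed-apart : ∀ J → Unique J → All NonInvolution J →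
                 (∀ {i j} → i ∈ J → j ∈ J → i ≢ j → NZ (x i + x j)) →
                 AllPairs _≉_ (map x J ++ map (λ i → - x i) J)
  signed-apart J u ninv pair = AllPairs.++⁺
    (AllPairs.map⁺ (AllPairs.map x≉ u))
    (AllPairs.map⁺ (AllPairs.map (λ {i} {j} i≢j → nz⁻ (x≉ i≢j) (negate (x i) (x j))) u))
    (All.map⁺ (All.tabulate λ i∈J → All.map⁺ (All.tabulate λ j∈J → opposite i∈J j∈J)))
    where
    negate : ∀ p q → - (p - q) ≡ - p - - q
    negate = ℤ-Solver.solve-∀
    add : ∀ p q → p + q ≡ p - - q
    add = ℤ-Solver.solve-∀
    opposite : ∀ {i j} → i ∈ J → j ∈ J → x i ≉ - x j
    opposite {i} {j} i∈J j∈J with i Fin.≟ j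
    ... | yes refl = nz⁺ (All.lookup ninv i∈J) (add (x i) (x i))
    ... | no  i≢j  = nz⁺ (pair i∈J j∈J i≢j) (add (x i) (x j))

  length-signed : ∀ J → length (map x J ++ map (λ i → - x i) J) ≡ length J ℕ.* 2
  length-signed J = begin
    length (map x J ++ map (λ i → - x i) J)        ≡⟨ length-++ (map x J) ⟩
    length (map x J) ℕ.+ length (map (λ i → - x i) J)
      ≡⟨ cong₂ ℕ._+_ (length-map x J) (length-map (λ i → - x i) J) ⟩
    length J ℕ.+ length J                          ≡⟨ cong (length J ℕ.+_) (ℕ.+-identityʳ (length J)) ⟨
    2 ℕ.* length J                                 ≡⟨ ℕ.*-comm 2 (length J) ⟩
    length J ℕ.* 2                                 ∎
    where open ≡-Reasoning

  -- The residues `± x i` are pairwise incongruent. An element of order two is its own negative, and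
  -- zero takes the place of the lost value.
  2∣support∣≤m : ∀ {ν R I} → Minimal ν → ⟦ I ⟧ ⊕ R ≡ ν → Unique I → 3 ≤ length I →
                 length I ℕ.* 2 ≤ suc n
  2∣support∣≤m {R = R} {I} min eq u 3≤I with split-involution I u
  ... | inj₁ ninv = subst (_≤ suc n) (length-signed I)
    (apart⇒length≤m (signed-apart I u ninv (pair≉0 {R = R} min eq 3≤I)))
  ... | inj₂ (c , J , p , 2c≈0 , ninv) with c∉J ∷ u′ ← Unique-resp-↭ p u =
    subst (_≤ suc n) (trans (cong (2 ℕ.+_) (length-signed J)) (cong (ℕ._* 2) (sym (↭-length p))))
      (apart⇒length≤m {0ℤ ∷ x c ∷ map x J ++ map (λ i → - x i) J}
        ( (nz⁻ (x≉0 c) (sym (ℤ.+-identityˡ _)) ∷ All.++⁺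
            (All.map⁺ (All.universal (λ i → nz⁻ (x≉0 i) (sym (ℤ.+-identityˡ _))) J))
            (All.map⁺ (All.universal (λ i → nz⁺ (x≉0 i) (from-zero (x i))) J)))
        ∷ All.++⁺ (All.map⁺ (All.map x≉ c∉J))
            (All.map⁺ (All.tabulate λ {i} i∈J →
              nz⁺ (pair (here refl) (there i∈J) (All.lookup c∉J i∈J)) (add (x c) (x i))))
        ∷ signed-apart J u′ ninv (λ i∈J j∈J → pair (there i∈J) (there j∈J))))
    where
    from-zero : ∀ p → p ≡ 0ℤ - - p
    from-zero = ℤ-Solver.solve-∀
    add : ∀ p q → p + q ≡ p - - q
    add = ℤ-Solver.solve-∀
    pair : ∀ {i j} → i ∈ c ∷ J → j ∈ c ∷ J → i ≢ j → NZ (x i + x j)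
    pair i∈ j∈ = pair≉0 {R = R} min eq 3≤I (∈-resp-↭ (↭-sym p) i∈) (∈-resp-↭ (↭-sym p) j∈)

  -- Two different elements, each repeated

  spread-pair : ∀ {a b} → a ≢ b → ZeroSumFree ⟦ a ∷ b ∷ [] ⟧ → Spread ⟦ a ∷ b ∷ [] ⟧ 3
  spread-pair {a} {b} a≢b zsf = record
    { values = _
    ; size   = refl
    ; apart  = three-apart (x a) (x b) (x≉0 a) (x≉0 b) (x≉ a≢b)
    ; sums   = Σx-isSum [a] ∷ Σx-isSum [b] ∷ Σx-isSum [ab] ∷ []
    }
    where
    [a] : a ∷ [] ⊆ a ∷ b ∷ []
    [a] = refl ∷ b ∷ʳ []
    [b] : b ∷ [] ⊆ a ∷ b ∷ []
    [b] = a ∷ʳ refl ∷ []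
    [ab] : a ∷ b ∷ [] ⊆ a ∷ b ∷ []
    [ab] = refl ∷ refl ∷ []

  -- Two blocks `a b` with three sums each give six values for four elements, an excess of two.
  deg+2≤m : ∀ {ν a b R} → Minimal ν → a ≢ b → (⟦ a ∷ b ∷ [] ⟧ ⊕ ⟦ a ∷ b ∷ [] ⟧) ⊕ R ≡ ν →
            deg ν ℕ.+ 2 ≤ suc n
  deg+2≤m {ν} {a} {b} {R} min a≢b eq = spread⇒deg+h≤m min eq
    (subst (Spread (⟦ a ∷ b ∷ [] ⟧ ⊕ ⟦ a ∷ b ∷ [] ⟧)) size6
      (spread-⊕ min eq (spread-pair a≢b zsf) (spread-pair a≢b zsf)))
    where
    zsf : ZeroSumFree ⟦ a ∷ b ∷ [] ⟧
    zsf = minimal⇒zeroSumFree min (trans (sym (⊕.assoc _ _ R)) eq) (⊕-≢𝟎ˡ (⊕-≢𝟎ˡ (e≢𝟎 a)))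
    size6 : 6 ≡ deg (⟦ a ∷ b ∷ [] ⟧ ⊕ ⟦ a ∷ b ∷ [] ⟧) ℕ.+ 2
    size6 = cong (ℕ._+ 2) (sym (trans (cong deg (sym (⟦⟧-++ (a ∷ b ∷ []) (a ∷ b ∷ []))))
      (deg-⟦⟧ (a ∷ b ∷ a ∷ b ∷ []))))

  -- Support a, b, a + b with 2a = 0

  spread-bbc : ∀ {a b c} → a ≢ b → b ≢ c → x a + x b ≈ x c → ZeroSumFree ⟦ b ∷ b ∷ c ∷ [] ⟧ →
               Spread ⟦ b ∷ b ∷ c ∷ [] ⟧ 5
  spread-bbc {a} {b} {c} a≢b b≢c a+b≈c zsf = record
    { values = _
    ; size   = refl
    ; apart  = five-apart (x a) (x b) (x c) (x≉0 b) (x≉0 c) (Σx≉0 zsf [bb]) (Σx≉0 zsf [bc])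
                 (x≉ a≢b) (x≉ b≢c) a+b≈c
    ; sums   = Σx-isSum [b] ∷ Σx-isSum [c] ∷ Σx-isSum [bb] ∷ Σx-isSum [bc] ∷ Σx-isSum [bbc] ∷ []
    }
    where
    [b] : b ∷ [] ⊆ b ∷ b ∷ c ∷ []
    [b] = b ∷ʳ refl ∷ c ∷ʳ []
    [c] : c ∷ [] ⊆ b ∷ b ∷ c ∷ []
    [c] = b ∷ʳ b ∷ʳ refl ∷ []
    [bb] : b ∷ b ∷ [] ⊆ b ∷ b ∷ c ∷ []
    [bb] = refl ∷ refl ∷ c ∷ʳ []
    [bc] : b ∷ c ∷ [] ⊆ b ∷ b ∷ c ∷ []
    [bc] = b ∷ʳ refl ∷ refl ∷ []
    [bbc] : b ∷ b ∷ c ∷ [] ⊆ b ∷ b ∷ c ∷ []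
    [bbc] = refl ∷ refl ∷ refl ∷ []

  -- Stated by congruences, as the bound delivers them; the two explicit vectors are found
  -- afterwards by a finite search.
  Exception : Exponents n → Set
  Exception ν = n ≡ 5 × ∃[ a ] ∃₂ λ b c →
    ⟦ a ∷ b ∷ b ∷ c ∷ [] ⟧ ≡ ν × D (x a + x a) × x a + x b ≈ x c

  -- If `R` is nonzero, the block `a b b c` is zero-sum free and has 5 + 2 sums, an excess of three.
  -- Otherwise `deg ν` is 4 and the blocks `b b c` and `a` give 5 + 1 ≤ m, so only m = 6 violates 4
  -- + 3 ≤ m.
  abbc-bound : ∀ {ν a b c R} → Minimal ν → a ≢ b → b ≢ c → D (x a + x a) → x a + x b ≈ x c →
               ⟦ a ∷ b ∷ b ∷ c ∷ [] ⟧ ⊕ R ≡ ν → deg ν ℕ.+ 3 ≤ suc n ⊎ Exception ν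
  abbc-bound {ν} {a} {b} {c} {R} min a≢b b≢c 2a≈0 a+b≈c eq with Vec.≡-dec ℕ._≟_ R 𝟎
  ... | no R≢𝟎 = inj₁ (spread⇒deg+h≤m min eq
    (subst (Spread ⟦ a ∷ b ∷ b ∷ c ∷ [] ⟧) (cong (ℕ._+ 3) (sym (deg-⟦⟧ (a ∷ b ∷ b ∷ c ∷ []))))
      (spread-extend refl zsf (involution-new refl zsf 2a≈0 (⊕-≢𝟎ˡ (e≢𝟎 b)))
        (spread-bbc a≢b b≢c a+b≈c (zeroSumFree-⊕ (⊕.comm ⟦ b ∷ b ∷ c ∷ [] ⟧ (e a)) zsf)))))
    where
    zsf : ZeroSumFree ⟦ a ∷ b ∷ b ∷ c ∷ [] ⟧
    zsf = minimal⇒zeroSumFree min eq R≢𝟎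
  ... | yes refl with suc n ℕ.≟ 6
  ...   | yes refl = inj₂ (refl , a , b , c , trans (sym (⊕.identityʳ _)) eq , 2a≈0 , a+b≈c)
  ...   | no  m≢6  = inj₁ (subst (λ d → d ℕ.+ 3 ≤ suc n) deg≡4 (ℕ.≤∧≢⇒< 6≤m (m≢6 ∘ sym)))
    where
    rotate : (⟦ b ∷ b ∷ c ∷ [] ⟧ ⊕ e a) ⊕ 𝟎 ≡ ν
    rotate = trans (cong (_⊕ 𝟎) (⊕.comm ⟦ b ∷ b ∷ c ∷ [] ⟧ (e a))) eq
    6≤m : 6 ≤ suc n
    6≤m = spread⇒≤ (spread-⊕ min rotate
      (spread-bbc a≢b b≢c a+b≈c (minimal⇒zeroSumFree min (trans (sym (⊕.identityʳ _)) rotate) (e≢𝟎 a)))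
      (spread-e a))
    deg≡4 : 4 ≡ deg ν
    deg≡4 = trans (sym (deg-⟦⟧ (a ∷ b ∷ b ∷ c ∷ []))) (cong deg (trans (sym (⊕.identityʳ _)) eq))

  -- The repeated element is not `a`, since `a a` would be a proper part of sum zero. The roles of
  -- `b` and `c` can be exchanged, because `2a ≈ 0` turns `c ≈ a + b` into `b ≈ a + c`.
  degenerate-bound : ∀ {ν R I} → Minimal ν → ⟦ I ⟧ ⊕ R ≡ ν → Unique I → Degenerate I →
                     (∃₂ λ i W → e i ⊕ W ≡ R × i ∈ I) → deg ν ℕ.+ 3 ≤ suc n ⊎ Exception ν
  degenerate-bound {ν} {R} {I} min eq u (a , b , c , p , 2a≈0 , a+b≈c) (i , W , eqR , i∈I)
    with (a≢b ∷ a≢c ∷ []) ∷ (b≢c ∷ []) ∷ _ ← Unique-resp-↭ p u | ∈-resp-↭ p i∈I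
  ... | here refl = contradiction 2a≈0 (∤ (nz⁺
    (min {⟦ a ∷ a ∷ [] ⟧} {⟦ b ∷ c ∷ [] ⟧ ⊕ W}
      (trans (solve 4 (λ a b c w → (a ⊕′ a ⊕′ id) ⊕′ (b ⊕′ c ⊕′ id) ⊕′ w ⊜ (a ⊕′ b ⊕′ c ⊕′ id) ⊕′ a ⊕′ w)
               refl (e a) (e b) (e c) W) whole)
      (⊕-≢𝟎ˡ (e≢𝟎 a)) (⊕-≢𝟎ˡ (⊕-≢𝟎ˡ (e≢𝟎 b))))
    (w-⟦⟧ (a ∷ a ∷ []))))
    where
    whole : ⟦ a ∷ b ∷ c ∷ [] ⟧ ⊕ e a ⊕ W ≡ ν
    whole = trans (cong₂ _⊕_ (sym (⟦⟧-↭ p)) eqR) eq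
  ... | there (here refl) = abbc-bound min a≢b b≢c 2a≈0 a+b≈c
    (trans (solve 4 (λ a b c w → (a ⊕′ b ⊕′ b ⊕′ c ⊕′ id) ⊕′ w ⊜ (a ⊕′ b ⊕′ c ⊕′ id) ⊕′ b ⊕′ w)
             refl (e a) (e b) (e c) W) (trans (cong₂ _⊕_ (sym (⟦⟧-↭ p)) eqR) eq))
  ... | there (there (here refl)) = abbc-bound min a≢c (b≢c ∘ sym) 2a≈0
    (subst D (exchange (x a) (x b) (x c)) (∣m∣n⇒∣m-n 2a≈0 a+b≈c))
    (trans (solve 4 (λ a b c w → (a ⊕′ c ⊕′ c ⊕′ b ⊕′ id) ⊕′ w ⊜ (a ⊕′ b ⊕′ c ⊕′ id) ⊕′ c ⊕′ w)
             refl (e a) (e b) (e c) W) (trans (cong₂ _⊕_ (sym (⟦⟧-↭ p)) eqR) eq))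
    where
    exchange : ∀ p q r → (p + p) - (p + q - r) ≡ p + r - q
    exchange = ℤ-Solver.solve-∀

  -- Bounds for three or more variables and for at most two

  deg+σ≤m : ∀ {ν} → Minimal ν → 3 ≤ σ ν → deg ν ℕ.+ σ ν ≤ suc n ⊎ Exception ν
  deg+σ≤m {ν} min 3≤σ = subst (λ s → deg ν ℕ.+ s ≤ suc n ⊎ Exception ν) (length-support ν)
    (bound (Vec.≡-dec ℕ._≟_ R 𝟎) (ℕ.<-cmp 3 (length I)))
    where
    I = support ν
    R = Vec.map pred ν
    eq : ⟦ I ⟧ ⊕ R ≡ ν
    eq = ⟦support⟧⊕pred ν
    u : Unique I
    u = support-unique ν
    3≤I : 3 ≤ length I
    3≤I = subst (3 ≤_) (sym (length-support ν)) 3≤σ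
    double : length I ℕ.* 2 ≡ deg ⟦ I ⟧ ℕ.+ length I
    double = trans (ℕ.*-comm (length I) 2)
      (cong₂ ℕ._+_ (sym (deg-⟦⟧ I)) (ℕ.+-identityʳ (length I)))
    repeated : R ≢ 𝟎 → ∃₂ λ i W → e i ⊕ W ≡ R × i ∈ I
    repeated R≢𝟎 with i , W , eqR ← split-≢𝟎 R≢𝟎 = i , W , eqR , subst (λ V → i ∈ support V)
      (trans (solve 3 (λ a b c → a ⊕′ b ⊕′ c ⊜ b ⊕′ a ⊕′ c) refl (e i) ⟦ I ⟧ W)
        (trans (cong (⟦ I ⟧ ⊕_) eqR) eq))
      (∈-support i (⟦ I ⟧ ⊕ W))
    bound : Dec (R ≡ 𝟎) → Tri (3 < length I) (3 ≡ length I) (length I < 3) →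
            deg ν ℕ.+ length I ≤ suc n ⊎ Exception ν
    -- Squarefree case: `deg ν` is the size s of the support, and the claim becomes 2s ≤ m.
    bound (yes R≡𝟎) _ = inj₁ (subst (_≤ suc n)
      (trans double (cong (λ V → deg V ℕ.+ length I)
        (trans (sym (⊕.identityʳ ⟦ I ⟧)) (trans (cong (⟦ I ⟧ ⊕_) (sym R≡𝟎)) eq))))
      (2∣support∣≤m min eq u 3≤I))
    -- The bound is decidable, so it may be proved under the double negation of `spread-support`.
    bound (no R≢𝟎) (tri< 3<I _ _) = inj₁ (decidable-stable (_ ℕ.≤? _) λ ¬bound →
      spread-support I 3<I u (minimal⇒zeroSumFree min eq R≢𝟎)
        (¬bound ∘ spread⇒deg+h≤m min eq ∘ subst (Spread ⟦ I ⟧) double))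
    bound (no R≢𝟎) (tri> _ _ I<3) = contradiction 3≤I (ℕ.<⇒≱ I<3)
    bound (no R≢𝟎) (tri≈ _ 3≡I _)
      with six-sums-or-degenerate I (sym 3≡I) u (minimal⇒zeroSumFree min eq R≢𝟎)
    ... | inj₁ s = inj₁ (spread⇒deg+h≤m min eq
                     (subst (Spread ⟦ I ⟧) (trans (cong (ℕ._* 2) 3≡I) double) s))
    ... | inj₂ d = subst (λ s → deg ν ℕ.+ s ≤ suc n ⊎ Exception ν) 3≡I
                     (degenerate-bound min eq u d (repeated R≢𝟎))

  -- A single variable has exponent m. Two exponents add up to `n`, that is m - 1, and by `deg+2≤m`
  -- they cannot both exceed 1, so the other is at least m - 2.
  large-exponent : ∀ {ν} → Minimal ν → deg ν ℕ.+ σ ν ≡ suc n ℕ.+ 1 → σ ν ≤ 2 →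
                   ∃[ i ] n ℕ.∸ 1 ≤ lookup ν i
  large-exponent {ν} min deg+σ σ≤2 =
    cases (support ν) (support-unique ν) (⟦support⟧⊕pred ν) (deg≡Σsupport ν)
      (trans (cong (deg ν ℕ.+_) (length-support ν)) deg+σ)
      (subst (_≤ 2) (sym (length-support ν)) σ≤2)
    where
    R = Vec.map pred ν
    large : ∀ i j → lookup ν j ≤ 1 → n ≡ lookup ν j ℕ.+ lookup ν i → n ℕ.∸ 1 ≤ lookup ν i
    large i j ≤1 n≡ = ℕ.m≤n+o⇒m∸n≤o n 1
      (ℕ.≤-trans (ℕ.≤-reflexive n≡) (ℕ.+-monoˡ-≤ (lookup ν i) ≤1))
    repeated : ∀ i → ¬ lookup ν i ≤ 1 → lookup R i ≢ 0
    repeated i ≰1 eq = ≰1 (pred≡0⇒≤1 (trans (sym (Vec.lookup-map i pred ν)) eq))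
      where
      pred≡0⇒≤1 : ∀ {k} → pred k ≡ 0 → k ≤ 1
      pred≡0⇒≤1 {zero}  _    = z≤n
      pred≡0⇒≤1 {suc _} refl = s≤s z≤n
    two-variables : ∀ y z → deg ν ≡ y ℕ.+ (z ℕ.+ 0) → deg ν ℕ.+ 2 ≡ suc n ℕ.+ 1 → n ≡ y ℕ.+ z
    two-variables y z deg≡ deg+2 = trans (sym (ℕ.+-cancelʳ-≡ 2 _ _ (trans deg+2 (sym (ℕ.+-suc n 1)))))
      (trans deg≡ (cong (y ℕ.+_) (ℕ.+-identityʳ z)))
    cases : ∀ I → Unique I → ⟦ I ⟧ ⊕ R ≡ ν → deg ν ≡ sum (map (lookup ν) I) →
            deg ν ℕ.+ length I ≡ suc n ℕ.+ 1 → length I ≤ 2 → ∃[ i ] n ℕ.∸ 1 ≤ lookup ν i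
    cases [] _ _ deg≡ deg+I _ =
      contradiction (trans (sym (trans (ℕ.+-identityʳ _) deg≡)) deg+I) λ ()
    cases (a ∷ []) _ _ deg≡ deg+I _ = a , ℕ.≤-trans (ℕ.m∸n≤m n 1) (ℕ.≤-trans (ℕ.n≤1+n n)
      (ℕ.≤-reflexive (trans (sym (ℕ.+-cancelʳ-≡ 1 _ _ deg+I)) (trans deg≡ (ℕ.+-identityʳ _)))))
    cases (a ∷ b ∷ []) ((a≢b ∷ []) ∷ _) split deg≡ deg+I _
      with lookup ν a ℕ.≤? 1 | lookup ν b ℕ.≤? 1
    ... | yes νa≤1 | _ = b , large b a νa≤1 (two-variables (lookup ν a) (lookup ν b) deg≡ deg+I)
    ... | no _ | yes νb≤1 = a , large a b νb≤1
      (trans (two-variables (lookup ν a) (lookup ν b) deg≡ deg+I) (ℕ.+-comm (lookup ν a) (lookup ν b)))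
    -- `R` still contains both `a` and `b`, so two copies of the pair can be split off `ν`.
    ... | no νa≰1 | no νb≰1
      with V , eqV ← split-lookup R a (repeated a νa≰1)
      with W , refl ← split-lookup V b (λ eq → repeated b νb≰1
        (trans (cong (λ U → lookup U b) (sym eqV))
          (trans (lookup-⊕ b (e a) V) (cong₂ ℕ._+_ (lookup-e-≢ a≢b) eq)))) =
      contradiction deg+I (ℕ.<⇒≢ (ℕ.≤-<-trans (deg+2≤m {R = W} min a≢b
        (trans (solve 3 (λ a b w → ((a ⊕′ b ⊕′ id) ⊕′ (a ⊕′ b ⊕′ id)) ⊕′ w ⊜ (a ⊕′ b ⊕′ id) ⊕′ a ⊕′ b ⊕′ w)
                 refl (e a) (e b) W)
          (trans (cong (⟦ a ∷ b ∷ [] ⟧ ⊕_) eqV) split))) (ℕ.m<m+n (suc n) (s≤s z≤n))))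
    cases (_ ∷ _ ∷ _ ∷ _) _ _ _ _ (s≤s (s≤s ()))

-- The exceptional monomials for m = 6

ν₁₃₄₄ ν₂₂₃₅ : Exponents 5
ν₁₃₄₄ = 1 ∷ 0 ∷ 1 ∷ 2 ∷ 0 ∷ []
ν₂₂₃₅ = 0 ∷ 2 ∷ 1 ∷ 0 ∷ 1 ∷ []

-- Here `x a` is 3 and `x c ≈ x b + 3`, so the weight is congruent to three times `x b` modulo 6 and
-- `x b` is 2 or 4. All triples are checked by decision.
exception-classified : ∀ {ν} → let open SubsetSums 5 in
  D (w ν) → Exception ν → ν ≡ ν₁₃₄₄ ⊎ ν ≡ ν₂₂₃₅
exception-classified wν≈0 (_ , a , b , c , refl , 2a≈0 , a+b≈c) = search a b c 2a≈0 a+b≈c wν≈0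
  where
  open import Data.Integer using (_+_; _-_)
  open SubsetSums 5
  abbc : (a b c : Fin 5) → Exponents 5
  abbc a b c = ⟦ a ∷ b ∷ b ∷ c ∷ [] ⟧
  search : ∀ a b c → D (x a + x a) → x a + x b ≈ x c → D (w (abbc a b c)) →
           abbc a b c ≡ ν₁₃₄₄ ⊎ abbc a b c ≡ ν₂₂₃₅
  search = from-yes (Fin.all? λ a → Fin.all? λ b → Fin.all? λ c →
    (+ 6 ∣? x a + x a) →-dec (+ 6 ∣? x a + x b - x c) →-dec (+ 6 ∣? w (abbc a b c)) →-dec
    (Vec.≡-dec ℕ._≟_ (abbc a b c) ν₁₃₄₄ ⊎-dec Vec.≡-dec ℕ._≟_ (abbc a b c) ν₂₂₃₅))

-- Monomials as polynomials

module _ {c ℓ₁ ℓ₂} (k : HeytingField c ℓ₁ ℓ₂) where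

  private
    module k = CommutativeRing
      (HeytingCommutativeRing.commutativeRing (HeytingField.heytingCommutativeRing k))

  -- The list is literally a single term, which products preserve, so exponents are compared by `≡`;
  -- the coefficient is a product of ones and equals 1 only up to `≈`.
  record Monic {n} (p : Polynomial k n) (ν : Exponents n) : Set (c ⊔ ℓ₁) where
    constructor monic
    field
      {a} : k.Carrier
      p≡  : p ≡ (a , ν) ∷ []
      a≈1 : a k.≈ k.1#

  module _ {n : ℕ} where
    open RawSemiring (k[X] k n) using (_≈_) renaming (_*_ to infixl 7 _⊗_; 1# to 𝟏)
    open RawSemiringDefinitions (k[X] k n) using (_^_; product)
    open RawMonoidDefinitions (⊕.rawMonoid {n}) using () renaming (_×_ to _×′_; sum to Σ)

    monic-≈ : ∀ {p q : Polynomial k n} {μ ν} → Monic p μ → Monic q ν → μ ≡ ν → p ≈ q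
    monic-≈ {ν = ν} (monic refl a≈1) (monic refl b≈1) refl ξ with does (Vec.≡-dec ℕ._≟_ ν ξ)
    ... | true  = k.+-congʳ (k.trans a≈1 (k.sym b≈1))
    ... | false = k.refl

    monic-⊗ : ∀ {p q : Polynomial k n} {μ ν} → Monic p μ → Monic q ν → Monic (p ⊗ q) (μ ⊕ ν)
    monic-⊗ (monic refl a≈1) (monic refl b≈1) =
      monic refl (k.trans (k.*-cong a≈1 b≈1) (k.*-identityˡ k.1#))

    monic-𝟏 : Monic 𝟏 𝟎
    monic-𝟏 = monic refl k.refl

    monic-X : ∀ (i : Fin n) → Monic (X k i) (e i)
    monic-X i = monic refl k.refl

    monic-^ : ∀ {p : Polynomial k n} {ν} → Monic p ν → ∀ j → Monic (p ^ j) (j ×′ ν)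
    monic-^ p zero    = monic-𝟏
    monic-^ p (suc j) = monic-⊗ p (monic-^ p j)

    monic-product : ∀ {l} {p : Fin l → Polynomial k n} {μ : Fin l → Exponents n} →
                    (∀ i → Monic (p i) (μ i)) → Monic (product p) (Σ μ)
    monic-product {zero}  _     = monic-𝟏
    monic-product {suc l} ps = monic-⊗ (ps zero) (monic-product (ps ∘ suc))

    monic-X^ : ∀ (ν : Exponents n) → Monic (X^_ k ν) (Σ λ i → lookup ν i ×′ e i)
    monic-X^ ν = monic-product λ i → monic-^ (monic-X i) (lookup ν i)

  module _ where
    open RawSemiring (k[X] k 5) using (_≈_) renaming (_*_ to infixl 7 _⊗_)
    open RawSemiringDefinitions (k[X] k 5) using (_^_)

    X^ν₁₃₄₄ : (X^_ k ν₁₃₄₄) ≈ X k (# 0) ⊗ X k (# 2) ⊗ X k (# 3) ^ 2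
    -- Both exponent vectors are closed terms that evaluate to `ν₁₃₄₄`, hence `refl`.
    X^ν₁₃₄₄ = monic-≈ (monic-X^ ν₁₃₄₄)
      (monic-⊗ (monic-⊗ (monic-X (# 0)) (monic-X (# 2))) (monic-^ (monic-X (# 3)) 2)) refl

    X^ν₂₂₃₅ : (X^_ k ν₂₂₃₅) ≈ X k (# 1) ^ 2 ⊗ X k (# 2) ⊗ X k (# 4)
    X^ν₂₂₃₅ = monic-≈ (monic-X^ ν₂₂₃₅)
      (monic-⊗ (monic-⊗ (monic-^ (monic-X (# 1)) 2) (monic-X (# 2))) (monic-X (# 4))) refl

    exceptional-invariant : ∀ {f ν} → f ≈ (X^_ k ν) → ν ≡ ν₁₃₄₄ ⊎ ν ≡ ν₂₂₃₅ → IsExceptional k 6 f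
    exceptional-invariant f≈ (inj₁ refl) = inj₁ λ μ → k.trans (f≈ μ) (X^ν₁₃₄₄ μ)
    exceptional-invariant f≈ (inj₂ refl) = inj₂ λ μ → k.trans (f≈ μ) (X^ν₂₂₃₅ μ)

-- From indecomposability to the three statements

indecomposable⇒minimal : ∀ {n ν} → IsIndecomposable (suc n) ν → SubsetSums.Minimal n ν
-- If `w U` vanished, `U` would be a nonzero solution below `ν`, hence all of `ν`, and cancellation
-- would leave nothing for `V`.
indecomposable⇒minimal {n} ind {U} {V} eq U≢𝟎 V≢𝟎 = nz λ d → V≢𝟎 (⊕-cancelˡ U
  (trans eq (trans (sym (minimal U (record { m∣weight = ∣⇒∣ᵤ d ; nonzero = U≢𝟎 }) (⊕⇒≤ eq)))
    (sym (⊕.identityʳ U)))))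
  where
  open IsIndecomposable ind
  open SubsetSums n

open import Data.Nat using (_+_; _∸_)

corollary4 : ∀ {c ℓ₁ ℓ₂} (m : ℕ) → 2 ≤ m →
    (k : HeytingField c ℓ₁ ℓ₂) (ε : HeytingField.Carrier k) → IsPrimitiveRoot k m ε →
    (f : Polynomial k (m ∸ 1)) (ν : Exponents (m ∸ 1)) → IsFundamentalInvariant k m f ν →
    (deg ν + σ ν ≡ m + 1 → σ ν ≤ 2 ⊎ IsExceptional k m f)
    × (3 ≤ m → m ≢ 6 → deg ν + σ ν ≡ m + 1 → ∃[ i ] m ∸ 2 ≤ lookup ν i)
    × (7 ≤ m → 3 ≤ σ ν → deg ν ≤ m ∸ σ ν)
corollary4 {c} {ℓ₁} {ℓ₂} (suc n) 2≤m k ε _ f ν inv = part-i , part-ii , part-iii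
  where
  open IsFundamentalInvariant inv
  open SubsetSums n

  minimal : Minimal ν
  minimal = indecomposable⇒minimal isIndecomposable

  wν≈0 : D (w ν)
  wν≈0 = ∣ᵤ⇒∣ (IsNonzeroSolution.m∣weight (IsIndecomposable.isNonzeroSolution isIndecomposable))

  -- Common to (i) and (ii): for three or more variables `deg ν + σ ν ≤ m` contradicts the equation,
  -- so only the exceptions remain.
  few-variables : deg ν + σ ν ≡ suc n + 1 → σ ν ≤ 2 ⊎ Exception ν
  few-variables eq with σ ν ℕ.≤? 2
  ... | yes σ≤2 = inj₁ σ≤2
  ... | no  σ≰2 with deg+σ≤m minimal (ℕ.≰⇒> σ≰2)
  ...   | inj₁ ≤m  = contradiction eq (ℕ.<⇒≢ (ℕ.≤-<-trans ≤m (ℕ.m<m+n (suc n) (s≤s z≤n))))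
  ...   | inj₂ exc = inj₂ exc

  part-i : deg ν + σ ν ≡ suc n + 1 → σ ν ≤ 2 ⊎ IsExceptional k (suc n) f
  part-i eq with few-variables eq
  ... | inj₁ σ≤2 = inj₁ σ≤2
  ... | inj₂ exc@(refl , _) = inj₂ (exceptional-invariant k {f} {ν} f≈X^ν (exception-classified wν≈0 exc))

  part-ii : 3 ≤ suc n → suc n ≢ 6 → deg ν + σ ν ≡ suc n + 1 → ∃[ i ] n ∸ 1 ≤ lookup ν i
  part-ii _ m≢6 eq with few-variables eq
  ... | inj₁ σ≤2        = large-exponent minimal eq σ≤2
  ... | inj₂ (refl , _) = contradiction refl m≢6

  part-iii : 7 ≤ suc n → 3 ≤ σ ν → deg ν ≤ suc n ∸ σ ν
  part-iii 7≤m 3≤σ with deg+σ≤m minimal 3≤σ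
  ... | inj₁ ≤m         = ℕ.m+n≤o⇒m≤o∸n (deg ν) ≤m
  -- The exceptions have m = 6.
  ... | inj₂ (refl , _) = contradiction 7≤m λ { (s≤s (s≤s (s≤s (s≤s (s≤s (s≤s ())))))) }
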